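{- Let $\mathrm{Domb}(n)=\sum_{k=0}^{n}\binom{n}{k}^2\binom{2k}{k}\binom{2(n-k)}{n-k}$, and let $p$ be a prime with $p\equiv1\pmod 3$. Then \[\sum_{n=2}^{p-1}\frac{(n+1)^2}{n(n-1)}\cdot\frac{\mathrm{Domb}(n)}{16^n}\equiv\frac{3}{2}\pmod{p^2}.\]
   Context: A congruence between rational numbers whose denominators are coprime to $p$ is understood in the ring of rationals with denominators prime to $p$ ($p$-adic integers): $x\equiv y\pmod{p^2}$ means $(x-y)/p^2$ has denominator coprime to $p$. -}

module Defs where

open import Data.Integer.Base using (+_)
open import Data.List.Base using (map; foldr; upTo)
open import Data.Nat.Base using (ℕ; suc; 2+; _+_; _*_; _∸_; _^_; NonZero; NonTrivial)
open import Data.Nat.Combinatorics using (_C_)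
open import Data.Nat.Coprimality using (Coprime)
open import Data.Nat.ListAction using (sum)
open import Data.Nat.Properties using (m^n≢0)
open import Data.Rational.Base as ℚ using (ℚ; 0ℚ; _/_; ↧ₙ_)

Domb : ℕ → ℕ
Domb n = sum (map (λ k → (n C k) ^ 2 * ((2 * k) C k) * ((2 * (n ∸ k)) C (n ∸ k))) (upTo (suc n)))

summand : (n : ℕ) → .{{NonTrivial n}} → ℚ
summand n@(2+ _) = (+ ((n + 1) ^ 2) / (n * (n ∸ 1))) ℚ.* ((+ Domb n / 16 ^ n) {{m^n≢0 16 n}})

-- The sum over 2 ≤ n ≤ N - 1, reindexed by n = 2 + m with 0 ≤ m < N - 2.
sumFrom2Below : ℕ → ℚ
sumFrom2Below N = foldr ℚ._+_ 0ℚ (map (λ m → summand (2 + m)) (upTo (N ∸ 2)))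

-- ℚ is kept in lowest terms, so ↧ₙ is the reduced denominator of (x - y) / p ^ r.
infix 4 _≡_[mod_^_]
_≡_[mod_^_] : ℚ → ℚ → (p : ℕ) → ℕ → .{{NonZero p}} → Set
x ≡ y [mod p ^ r ] = Coprime (↧ₙ ((x ℚ.- y) ℚ.* ((+ 1 / p ^ r) {{m^n≢0 p r}}))) p

{-# OPTIONS --safe #-}

-- Put d n = Domb n / 16ⁿ. The three-term recurrence of d telescopes the sum:
--   2 Σ_{2≤n<N} (n+1)²/(n(n-1)) d n = 3 + Σ_{n<N} (3n+1) d n + 2N² d(N-1) - 8N³ d(N)/(N-1),
-- so for N = p it remains to see that Σ_{n<p} (3n+1) d n ≡ 0 (mod p²).
-- Expanding d n = Σ_k C(n+2k,3k) C(2k,k)² C(3k,k) / (-16)ᵏ, the sum over n has the closed form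
-- (3p-1) p z_k / (3k+2), where z_k ≡ C(2k,k)²/16ᵏ ≡ (-1)ᵏ C(m,k) C(m+k,k) (mod p) for
-- k ≤ m = (p-1)/2, and z_k ≡ 0 (mod p²) for larger k. Finally
-- Σ_k (-1)ᵏ C(m,k) C(m+k,k) / (k+2/3) = (1/3)_m / (2/3)_{m+1}, and for p ≡ 1 (mod 3) the
-- numerator contains the factor p/3 while the denominator is prime to p.
module Submission where

open import Defs
open import Data.Integer.Base as ℤ using (ℤ)
import Data.Integer.Properties as ℤ
open import Data.List.Base using ([]; _∷_; map; foldr; applyUpTo)
open import Data.Nat.Base as ℕ using (ℕ; zero; suc; _%_; _!; z≤n; s≤s; z<s; s<s)
open import Data.Nat.Combinatorics using (_C_; nCk≡n!/k![n-k]!; [n∸k]!k!∣n!)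
open import Data.Nat.Coprimality as Coprimality using (Coprime; coprime-divisor)
open import Data.Nat.Divisibility using (_∣_; _∣?_; divides; ∣1⇒≡1; ∣-trans; >⇒∤; m∣m*n; ∣m+n∣m⇒∣n)
open import Data.Nat.DivMod using (m/n*n≡m; m%n<n; m≡m%n+[m/n]*n)
open import Data.Nat.ListAction using (sum)
open import Data.Nat.Primality using (Prime; prime⇒nonZero; prime⇒irreducible; euclidsLemma; ¬prime[1])
import Data.Nat.Properties as ℕ
import Data.Nat.Tactic.RingSolver as ℕ-solver
open import Data.Product.Base using (∃; _×_; _,_; proj₁; proj₂)
open import Data.Rational.Base
open import Data.Rational.Properties
open import Data.Rational.Unnormalised.Base as ℚᵘ using (mkℚᵘ; *≡*)
import Data.Rational.Unnormalised.Properties as ℚᵘ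
open import Data.Sum.Base using (inj₁; inj₂; [_,_]′)
open import Function.Base using (_∘_)
open import Level using (0ℓ)
open import Relation.Binary.PropositionalEquality
open import Relation.Nullary.Decidable using (yes; no; dec⇒maybe)
open import Relation.Nullary.Negation using (¬_; contradiction)
open import Tactic.RingSolver using (solve; solve-∀)
open import Tactic.RingSolver.Core.AlmostCommutativeRing using (AlmostCommutativeRing; fromCommutativeRing)

open ≡-Reasoning

-- The recurrence comes from a differential equation: Domb n / n!² is the coefficient of xⁿ in w⁴
-- with w = Σ xᵃ/a!², and w solves an equation of order two, so w⁴ solves one of order five. The
-- expansion of `d n` is then justified by uniqueness: truncated sums of the expansion satisfy the
-- same recurrence and have the same two initial values. The weight 3n+1 makes every inner sum over
-- n summable in closed form, and that closed form shows a factor p, which is why z_k is needed only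
-- modulo p when 3k+2 is a p-adic unit. The obstacle is the denominator 3k+2. For k < p it is
-- divisible by p exactly once, at k = 2(p-1)/3, where it equals 2p. That k exceeds (p-1)/2, so z_k
-- there supplies p² and one factor p can be given up. Hypergeometric terms are given by their term
-- ratios, with a rational parameter, and are compared by relations free of division. Each identity
-- thereby reduces to a ring identity.

ℚ-ring : AlmostCommutativeRing 0ℓ 0ℓ
ℚ-ring = fromCommutativeRing +-*-commutativeRing (λ x → dec⇒maybe (0ℚ ≟ x))

-- Recursive rather than `ℤ.+ n / 1`: `⟦ suc n ⟧` unfolds to `1ℚ + ⟦ n ⟧`, so a ring identity in a
-- variable standing for `⟦ n ⟧` applies to shifted indices definitionally.
⟦_⟧ : ℕ → ℚ
⟦ zero ⟧  = 0ℚ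
⟦ suc n ⟧ = 1ℚ + ⟦ n ⟧

⟦⟧-homo-+ : ∀ m n → ⟦ m ℕ.+ n ⟧ ≡ ⟦ m ⟧ + ⟦ n ⟧
⟦⟧-homo-+ zero    n = sym (+-identityˡ ⟦ n ⟧)
⟦⟧-homo-+ (suc m) n = trans (cong (1ℚ +_) (⟦⟧-homo-+ m n)) (sym (+-assoc 1ℚ ⟦ m ⟧ ⟦ n ⟧))

⟦⟧-homo-* : ∀ m n → ⟦ m ℕ.* n ⟧ ≡ ⟦ m ⟧ * ⟦ n ⟧
⟦⟧-homo-* zero    n = sym (*-zeroˡ ⟦ n ⟧)
⟦⟧-homo-* (suc m) n = begin
  ⟦ n ℕ.+ m ℕ.* n ⟧        ≡⟨ ⟦⟧-homo-+ n (m ℕ.* n) ⟩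
  ⟦ n ⟧ + ⟦ m ℕ.* n ⟧      ≡⟨ cong (⟦ n ⟧ +_) (⟦⟧-homo-* m n) ⟩
  ⟦ n ⟧ + ⟦ m ⟧ * ⟦ n ⟧    ≡⟨ distrib ⟦ m ⟧ ⟦ n ⟧ ⟩
  (1ℚ + ⟦ m ⟧) * ⟦ n ⟧     ∎
  where
  distrib : ∀ x y → y + x * y ≡ (1ℚ + x) * y
  distrib = solve-∀ ℚ-ring

⟦⟧-homo-∸ : ∀ {m n} → n ℕ.≤ m → ⟦ m ℕ.∸ n ⟧ ≡ ⟦ m ⟧ - ⟦ n ⟧
⟦⟧-homo-∸ {m} {n} n≤m = begin
  ⟦ m ℕ.∸ n ⟧                        ≡⟨ cancel ⟦ m ℕ.∸ n ⟧ ⟦ n ⟧ ⟩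
  (⟦ m ℕ.∸ n ⟧ + ⟦ n ⟧) - ⟦ n ⟧      ≡⟨ cong (_- ⟦ n ⟧) (⟦⟧-homo-+ (m ℕ.∸ n) n) ⟨
  ⟦ m ℕ.∸ n ℕ.+ n ⟧ - ⟦ n ⟧          ≡⟨ cong (λ l → ⟦ l ⟧ - ⟦ n ⟧) (ℕ.m∸n+n≡m n≤m) ⟩
  ⟦ m ⟧ - ⟦ n ⟧                      ∎
  where
  cancel : ∀ x y → x ≡ (x + y) - y
  cancel = solve-∀ ℚ-ring

-- Fractions and reciprocals

/1-homo-+ : ∀ i j → (i ℤ.+ j) / 1 ≡ i / 1 + j / 1
/1-homo-+ i j = toℚᵘ-injective (begin′
  toℚᵘ ((i ℤ.+ j) / 1)              ≈⟨ toℚᵘ-fromℚᵘ (mkℚᵘ (i ℤ.+ j) 0) ⟩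
  mkℚᵘ (i ℤ.+ j) 0                  ≈⟨ *≡* (cong (ℤ._* ℤ.+ 1) (sym (cong₂ ℤ._+_ (ℤ.*-identityʳ i) (ℤ.*-identityʳ j)))) ⟩
  mkℚᵘ i 0 ℚᵘ.+ mkℚᵘ j 0            ≈⟨ ℚᵘ.+-cong (toℚᵘ-fromℚᵘ (mkℚᵘ i 0)) (toℚᵘ-fromℚᵘ (mkℚᵘ j 0)) ⟨
  toℚᵘ (i / 1) ℚᵘ.+ toℚᵘ (j / 1)    ≈⟨ toℚᵘ-homo-+ (i / 1) (j / 1) ⟨
  toℚᵘ (i / 1 + j / 1)              ∎′)
  where open ℚᵘ.≃-Reasoning renaming (begin_ to begin′_; _∎ to _∎′)

/1-homo-* : ∀ i j → (i ℤ.* j) / 1 ≡ i / 1 * (j / 1)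
/1-homo-* i j = toℚᵘ-injective (begin′
  toℚᵘ ((i ℤ.* j) / 1)              ≈⟨ toℚᵘ-fromℚᵘ (mkℚᵘ (i ℤ.* j) 0) ⟩
  mkℚᵘ i 0 ℚᵘ.* mkℚᵘ j 0            ≈⟨ ℚᵘ.*-cong (toℚᵘ-fromℚᵘ (mkℚᵘ i 0)) (toℚᵘ-fromℚᵘ (mkℚᵘ j 0)) ⟨
  toℚᵘ (i / 1) ℚᵘ.* toℚᵘ (j / 1)    ≈⟨ toℚᵘ-homo-* (i / 1) (j / 1) ⟨
  toℚᵘ (i / 1 * (j / 1))            ∎′)
  where open ℚᵘ.≃-Reasoning renaming (begin_ to begin′_; _∎ to _∎′)

⟦⟧≡/1 : ∀ n → ⟦ n ⟧ ≡ ℤ.+ n / 1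
⟦⟧≡/1 zero    = refl
⟦⟧≡/1 (suc n) = trans (cong (1ℚ +_) (⟦⟧≡/1 n)) (sym (/1-homo-+ (ℤ.+ 1) (ℤ.+ n)))

/-*-cancel : ∀ i n .{{_ : ℕ.NonZero n}} → i / n * ⟦ n ⟧ ≡ i / 1
/-*-cancel i n@(suc n-1) = trans (cong (i / n *_) (⟦⟧≡/1 n)) (toℚᵘ-injective (begin′
  toℚᵘ (i / n * (ℤ.+ n / 1))             ≈⟨ toℚᵘ-homo-* (i / n) (ℤ.+ n / 1) ⟩
  toℚᵘ (i / n) ℚᵘ.* toℚᵘ (ℤ.+ n / 1)     ≈⟨ ℚᵘ.*-cong (toℚᵘ-fromℚᵘ (mkℚᵘ i n-1)) (toℚᵘ-fromℚᵘ (mkℚᵘ (ℤ.+ n) 0)) ⟩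
  mkℚᵘ i n-1 ℚᵘ.* mkℚᵘ (ℤ.+ n) 0         ≈⟨ *≡* (trans (ℤ.*-identityʳ _) (cong (i ℤ.*_) (cong ℤ.+_ (sym (ℕ.*-identityʳ n))))) ⟩
  mkℚᵘ i 0                             ≈⟨ toℚᵘ-fromℚᵘ (mkℚᵘ i 0) ⟨
  toℚᵘ (i / 1)                         ∎′))
  where open ℚᵘ.≃-Reasoning renaming (begin_ to begin′_; _∎ to _∎′)

-- Junk value: recip 0 = 0.
recip : ℕ → ℚ
recip zero    = 0ℚ
recip (suc n) = ℤ.+ 1 / suc n

recip-inverseˡ : ∀ n .{{_ : ℕ.NonZero n}} → recip n * ⟦ n ⟧ ≡ 1ℚ
recip-inverseˡ (suc n) = /-*-cancel (ℤ.+ 1) (suc n)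

*⟦⟧-cancelʳ : ∀ n .{{_ : ℕ.NonZero n}} {x y} → x * ⟦ n ⟧ ≡ y * ⟦ n ⟧ → x ≡ y
*⟦⟧-cancelʳ n {x} {y} eq = begin
  x                          ≡⟨ *-identityʳ x ⟨
  x * 1ℚ                     ≡⟨ cong (x *_) (recip-inverseˡ n) ⟨
  x * (recip n * ⟦ n ⟧)      ≡⟨ swap x (recip n) ⟦ n ⟧ ⟩
  x * ⟦ n ⟧ * recip n        ≡⟨ cong (_* recip n) eq ⟩
  y * ⟦ n ⟧ * recip n        ≡⟨ swap y (recip n) ⟦ n ⟧ ⟨
  y * (recip n * ⟦ n ⟧)      ≡⟨ cong (y *_) (recip-inverseˡ n) ⟩
  y * 1ℚ                     ≡⟨ *-identityʳ y ⟩
  y                          ∎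
  where
  swap : ∀ a b c → a * (b * c) ≡ a * c * b
  swap = solve-∀ ℚ-ring

-- Finite sums

∑ : ℕ → (ℕ → ℚ) → ℚ
∑ zero    f = 0ℚ
∑ (suc n) f = f 0 + ∑ n (f ∘ suc)

∑-cong-< : ∀ n {f g : ℕ → ℚ} → (∀ k → k ℕ.< n → f k ≡ g k) → ∑ n f ≡ ∑ n g
∑-cong-< zero    eq = refl
∑-cong-< (suc n) eq = cong₂ _+_ (eq 0 z<s) (∑-cong-< n (λ k k<n → eq (suc k) (s<s k<n)))

∑-cong : ∀ n {f g : ℕ → ℚ} → (∀ k → f k ≡ g k) → ∑ n f ≡ ∑ n g
∑-cong n eq = ∑-cong-< n (λ k _ → eq k)

∑-zero : ∀ n → ∑ n (λ _ → 0ℚ) ≡ 0ℚ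
∑-zero zero    = refl
∑-zero (suc n) = trans (+-identityˡ _) (∑-zero n)

∑-+ : ∀ n (f g : ℕ → ℚ) → ∑ n (λ k → f k + g k) ≡ ∑ n f + ∑ n g
∑-+ zero    f g = refl
∑-+ (suc n) f g = trans (cong (f 0 + g 0 +_) (∑-+ n (f ∘ suc) (g ∘ suc))) (interchange (f 0) (g 0) _ _)
  where
  interchange : ∀ a b c d → a + b + (c + d) ≡ a + c + (b + d)
  interchange = solve-∀ ℚ-ring

∑-*ˡ : ∀ n c (f : ℕ → ℚ) → ∑ n (λ k → c * f k) ≡ c * ∑ n f
∑-*ˡ zero    c f = sym (*-zeroʳ c)
∑-*ˡ (suc n) c f = trans (cong (c * f 0 +_) (∑-*ˡ n c (f ∘ suc))) (sym (*-distribˡ-+ c (f 0) _))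

∑-neg : ∀ n (f : ℕ → ℚ) → ∑ n (λ k → - f k) ≡ - ∑ n f
∑-neg zero    f = refl
∑-neg (suc n) f = trans (cong (- f 0 +_) (∑-neg n (f ∘ suc))) (sym (neg-distrib-+ (f 0) _))

∑-last : ∀ n (f : ℕ → ℚ) → ∑ (suc n) f ≡ ∑ n f + f n
∑-last zero    f = trans (+-identityʳ (f 0)) (sym (+-identityˡ (f 0)))
∑-last (suc n) f = trans (cong (f 0 +_) (∑-last n (f ∘ suc))) (sym (+-assoc (f 0) _ _))

∑-split : ∀ m n (f : ℕ → ℚ) → ∑ (m ℕ.+ n) f ≡ ∑ m f + ∑ n (λ k → f (m ℕ.+ k))
∑-split zero    n f = sym (+-identityˡ _)
∑-split (suc m) n f = trans (cong (f 0 +_) (∑-split m n (f ∘ suc))) (sym (+-assoc (f 0) _ _))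

∑-swap : ∀ m n (f : ℕ → ℕ → ℚ) → ∑ m (λ i → ∑ n (f i)) ≡ ∑ n (λ j → ∑ m (λ i → f i j))
∑-swap zero    n f = sym (∑-zero n)
∑-swap (suc m) n f = trans (cong (∑ n (f 0) +_) (∑-swap m n (f ∘ suc))) (sym (∑-+ n (f 0) _))

∑-telescope : ∀ n {f : ℕ → ℚ} (G : ℕ → ℚ) → (∀ k → f k ≡ G (suc k) - G k) → ∑ n f ≡ G n - G 0
∑-telescope zero    G eq = sym (+-inverseʳ (G 0))
∑-telescope (suc n) G eq =
  trans (cong₂ _+_ (eq 0) (∑-telescope n (G ∘ suc) (eq ∘ suc))) (collapse (G 1) (G 0) (G (suc n)))
  where
  collapse : ∀ a b c → (a - b) + (c - a) ≡ c - b
  collapse = solve-∀ ℚ-ring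

-- Hypergeometric terms

hyp : (ℕ → ℚ) → (ℕ → ℕ) → ℕ → ℚ
hyp num den zero    = 1ℚ
hyp num den (suc k) = num k * hyp num den k * recip (den k)

hyp-step : ∀ num den k .{{_ : ℕ.NonZero (den k)}} → hyp num den (suc k) * ⟦ den k ⟧ ≡ num k * hyp num den k
hyp-step num den k = begin
  num k * hyp num den k * recip (den k) * ⟦ den k ⟧    ≡⟨ *-assoc (num k * hyp num den k) _ _ ⟩
  num k * hyp num den k * (recip (den k) * ⟦ den k ⟧)  ≡⟨ cong (num k * hyp num den k *_) (recip-inverseˡ (den k)) ⟩
  num k * hyp num den k * 1ℚ                           ≡⟨ *-identityʳ _ ⟩
  num k * hyp num den k                                ∎

hyp-vanish : ∀ num den {j k} → num j ≡ 0ℚ → j ℕ.< k → hyp num den k ≡ 0ℚ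
hyp-vanish num den {j} {suc k} num≡0 (s≤s j≤k) with ℕ.m≤n⇒m<n∨m≡n j≤k
... | inj₁ j<k = trans (cong (λ x → num k * x * recip (den k)) (hyp-vanish num den num≡0 j<k)) (zeroMid (num k) (recip (den k)))
  where
  zeroMid : ∀ a b → a * 0ℚ * b ≡ 0ℚ
  zeroMid = solve-∀ ℚ-ring
... | inj₂ refl = trans (cong (λ x → x * hyp num den k * recip (den k)) num≡0) (zeroLeft (hyp num den k) (recip (den k)))
  where
  zeroLeft : ∀ a b → 0ℚ * a * b ≡ 0ℚ
  zeroLeft = solve-∀ ℚ-ring

-- Both sides start at the same value and have the same term ratio `γ k / den k`. This yields
-- contiguous relations without dividing by `α` or `β`, which may vanish at integer parameters.
hyp-compare : ∀ (num num′ : ℕ → ℚ) den (α β γ : ℕ → ℚ) → α 0 ≡ β 0 →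
  (∀ k → α (suc k) * num k ≡ γ k * α k) → (∀ k → β (suc k) * num′ k ≡ γ k * β k) →
  ∀ k → α k * hyp num den k ≡ β k * hyp num′ den k
hyp-compare num num′ den α β γ α≡β α-step β-step zero    = cong (_* 1ℚ) α≡β
hyp-compare num num′ den α β γ α≡β α-step β-step (suc k) = begin
  α (suc k) * (num k * hyp num den k * r)       ≡⟨ regroup (α (suc k)) (num k) (hyp num den k) r ⟩
  α (suc k) * num k * hyp num den k * r         ≡⟨ cong (λ x → x * hyp num den k * r) (α-step k) ⟩
  γ k * α k * hyp num den k * r                 ≡⟨ cong (_* r) (*-assoc (γ k) (α k) _) ⟩
  γ k * (α k * hyp num den k) * r               ≡⟨ cong (λ x → γ k * x * r) (hyp-compare num num′ den α β γ α≡β α-step β-step k) ⟩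
  γ k * (β k * hyp num′ den k) * r              ≡⟨ cong (_* r) (*-assoc (γ k) (β k) _) ⟨
  γ k * β k * hyp num′ den k * r                ≡⟨ cong (λ x → x * hyp num′ den k * r) (β-step k) ⟨
  β (suc k) * num′ k * hyp num′ den k * r       ≡⟨ regroup (β (suc k)) (num′ k) (hyp num′ den k) r ⟨
  β (suc k) * (num′ k * hyp num′ den k * r)     ∎
  where
  r = recip (den k)
  regroup : ∀ a b c d → a * (b * c * d) ≡ a * b * c * d
  regroup = solve-∀ ℚ-ring

-- An equation that is a linear combination of e₁, e₂, … is proved by
-- combine (c₁ ⊡ e₁ ⊞ c₂ ⊡ e₂ ⊞ …) applied to a ring identity.
combine : ∀ {x y l r} → l ≡ r → x - y ≡ l - r → x ≡ y
combine {x} {y} {l} {r} l≡r eq = begin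
  x            ≡⟨ split x y ⟩
  (x - y) + y  ≡⟨ cong (_+ y) eq ⟩
  (l - r) + y  ≡⟨ cong (λ z → (z - r) + y) l≡r ⟩
  (r - r) + y  ≡⟨ merge r y ⟩
  y            ∎
  where
  split : ∀ x y → x ≡ (x - y) + y
  split = solve-∀ ℚ-ring
  merge : ∀ r y → (r - r) + y ≡ y
  merge = solve-∀ ℚ-ring

infixl 4 _⊞_
infixr 5 _⊡_

_⊞_ : ∀ {a b c d : ℚ} → a ≡ b → c ≡ d → a + c ≡ b + d
_⊞_ = cong₂ _+_

_⊡_ : ∀ {a b} (c : ℚ) → a ≡ b → c * a ≡ c * b
c ⊡ eq = cong (c *_) eq

-- The recurrence of the Domb numbers

-- Sequences are read as coefficients of power series: `conv` is the product, `θ` the derivation x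
-- d/dx and `X` multiplication by x.
conv : (ℕ → ℚ) → (ℕ → ℚ) → ℕ → ℚ
conv f g n = ∑ (suc n) (λ k → f k * g (n ℕ.∸ k))

θ : (ℕ → ℚ) → ℕ → ℚ
θ f n = ⟦ n ⟧ * f n

X : (ℕ → ℚ) → ℕ → ℚ
X f zero    = 0ℚ
X f (suc n) = f n

conv-congˡ : ∀ {f f′ : ℕ → ℚ} (g : ℕ → ℚ) → (∀ k → f k ≡ f′ k) → ∀ n → conv f g n ≡ conv f′ g n
conv-congˡ g f≗f′ n = ∑-cong (suc n) (λ k → cong (_* g (n ℕ.∸ k)) (f≗f′ k))

conv-last : ∀ (f g : ℕ → ℚ) n → conv f g (suc n) ≡ conv f (g ∘ suc) n + f (suc n) * g 0
conv-last f g n = trans (∑-last (suc n) (λ k → f k * g (suc n ℕ.∸ k))) (cong₂ _+_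
  (∑-cong-< (suc n) (λ { k (s≤s k≤n) → cong (λ l → f k * g l) (ℕ.+-∸-assoc 1 k≤n) }))
  (cong (λ l → f (suc n) * g l) (ℕ.n∸n≡0 n)))

conv-comm : ∀ (f g : ℕ → ℚ) n → conv f g n ≡ conv g f n
conv-comm f g zero    = cong (_+ 0ℚ) (*-comm (f 0) (g 0))
conv-comm f g (suc n) = begin
  f 0 * g (suc n) + conv (f ∘ suc) g n  ≡⟨ cong₂ _+_ (*-comm (f 0) (g (suc n))) (conv-comm (f ∘ suc) g n) ⟩
  g (suc n) * f 0 + conv g (f ∘ suc) n  ≡⟨ +-comm (g (suc n) * f 0) _ ⟩
  conv g (f ∘ suc) n + g (suc n) * f 0  ≡⟨ conv-last g f n ⟨
  conv g f (suc n)                      ∎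

conv-+ˡ : ∀ (f f′ g : ℕ → ℚ) n → conv (λ k → f k + f′ k) g n ≡ conv f g n + conv f′ g n
conv-+ˡ f f′ g n = trans (∑-cong (suc n) (λ k → *-distribʳ-+ (g (n ℕ.∸ k)) (f k) (f′ k)))
  (∑-+ (suc n) (λ k → f k * g (n ℕ.∸ k)) (λ k → f′ k * g (n ℕ.∸ k)))

conv-*ˡ : ∀ c (f g : ℕ → ℚ) n → conv (λ k → c * f k) g n ≡ c * conv f g n
conv-*ˡ c f g n = trans (∑-cong (suc n) (λ k → *-assoc c (f k) (g (n ℕ.∸ k))))
  (∑-*ˡ (suc n) c (λ k → f k * g (n ℕ.∸ k)))

conv-Xˡ : ∀ (f g : ℕ → ℚ) n → conv (X f) g n ≡ X (conv f g) n
conv-Xˡ f g zero    = trans (+-identityʳ _) (*-zeroˡ (g 0))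
conv-Xˡ f g (suc n) = trans (cong (_+ conv f g n) (*-zeroˡ (g (suc n)))) (+-identityˡ _)

θ-conv : ∀ (f g : ℕ → ℚ) n → θ (conv f g) n ≡ conv (θ f) g n + conv f (θ g) n
θ-conv f g n = begin
  ⟦ n ⟧ * conv f g n
    ≡⟨ ∑-*ˡ (suc n) ⟦ n ⟧ (λ k → f k * g (n ℕ.∸ k)) ⟨
  ∑ (suc n) (λ k → ⟦ n ⟧ * (f k * g (n ℕ.∸ k)))
    ≡⟨ ∑-cong-< (suc n) (λ { k (s≤s k≤n) → leibniz ⟦ n ⟧ ⟦ k ⟧ ⟦ n ℕ.∸ k ⟧ (f k) (g (n ℕ.∸ k)) (⟦⟧-homo-∸ k≤n) }) ⟩
  ∑ (suc n) (λ k → θ f k * g (n ℕ.∸ k) + f k * θ g (n ℕ.∸ k))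
    ≡⟨ ∑-+ (suc n) (λ k → θ f k * g (n ℕ.∸ k)) (λ k → f k * θ g (n ℕ.∸ k)) ⟩
  conv (θ f) g n + conv f (θ g) n ∎
  where
  leibniz : ∀ n k l x y → l ≡ n - k → n * (x * y) ≡ k * x * y + x * (l * y)
  leibniz n k l x y eq = combine ((- (x * y)) ⊡ eq) (solve (n ∷ k ∷ l ∷ x ∷ y ∷ []) ℚ-ring)

u-num : ℕ → ℚ
u-num a = ⟦ 2 ⟧ * (⟦ 2 ⟧ * ⟦ a ⟧ + 1ℚ)

u-den : ℕ → ℕ
u-den a = suc a ℕ.* suc a ℕ.* suc a

-- Coefficients of w², w θw and (θw)² for w = Σ xᵃ/a!², which satisfies θ²w = x w.
u₀ u₁ u₂ : ℕ → ℚ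
u₀ = hyp u-num u-den
u₁ a = ½ * ⟦ a ⟧ * u₀ a
u₂ a = ⟦ a ⟧ * u₁ a - X u₀ a

u₀-step : ∀ a → u₀ (suc a) * (⟦ suc a ⟧ * ⟦ suc a ⟧ * ⟦ suc a ⟧) ≡ ⟦ 2 ⟧ * (⟦ 2 ⟧ * ⟦ a ⟧ + 1ℚ) * u₀ a
u₀-step a = trans (cong (u₀ (suc a) *_) (sym cube)) (hyp-step u-num u-den a)
  where
  cube : ⟦ suc a ℕ.* suc a ℕ.* suc a ⟧ ≡ ⟦ suc a ⟧ * ⟦ suc a ⟧ * ⟦ suc a ⟧
  cube = trans (⟦⟧-homo-* (suc a ℕ.* suc a) (suc a)) (cong (_* ⟦ suc a ⟧) (⟦⟧-homo-* (suc a) (suc a)))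

θu₀ : ∀ a → θ u₀ a ≡ ⟦ 2 ⟧ * u₁ a
θu₀ a = identity ⟦ a ⟧ (u₀ a)
  where
  identity : ∀ a u → a * u ≡ ⟦ 2 ⟧ * (½ * a * u)
  identity = solve-∀ ℚ-ring

θu₁ : ∀ a → θ u₁ a ≡ u₂ a + X u₀ a
θu₁ a = identity (⟦ a ⟧ * u₁ a) (X u₀ a)
  where
  identity : ∀ x y → x ≡ x - y + y
  identity = solve-∀ ℚ-ring

-- This is θ((θw)²) = 2 θw θ²w = 2x w θw. Since `u₀` is given by its term ratio and not as a square,
-- the content in coefficients is half of `u₀-step`.
θu₂ : ∀ a → θ u₂ a ≡ ⟦ 2 ⟧ * X u₁ a
θu₂ zero    = refl
θu₂ (suc a) = identity ⟦ a ⟧ (u₀ a) (u₀ (suc a)) (u₀-step a)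
  where
  identity : ∀ a u u′ → u′ * ((1ℚ + a) * (1ℚ + a) * (1ℚ + a)) ≡ ⟦ 2 ⟧ * (⟦ 2 ⟧ * a + 1ℚ) * u →
    (1ℚ + a) * ((1ℚ + a) * (½ * (1ℚ + a) * u′) - u) ≡ ⟦ 2 ⟧ * (½ * a * u)
  identity a u u′ eq = combine (½ ⊡ eq) (solve (a ∷ u ∷ u′ ∷ []) ℚ-ring)

-- Eⱼ lists the coefficients of w⁴⁻ʲ (θw)ʲ, and E₀ n = Domb n / n!².
E₀ E₁ E₂ E₃ E₄ : ℕ → ℚ
E₀ = conv u₀ u₀
E₁ = conv u₀ u₁
E₂ = conv u₀ u₂
E₃ = conv u₁ u₂
E₄ = conv u₂ u₂

conv-θu₀ : ∀ g n → conv (θ u₀) g n ≡ ⟦ 2 ⟧ * conv u₁ g n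
conv-θu₀ g n = trans (conv-congˡ g θu₀ n) (conv-*ˡ ⟦ 2 ⟧ u₁ g n)

conv-θu₁ : ∀ g n → conv (θ u₁) g n ≡ conv u₂ g n + X (conv u₀ g) n
conv-θu₁ g n = trans (conv-congˡ g θu₁ n)
  (trans (conv-+ˡ u₂ (X u₀) g n) (cong (conv u₂ g n +_) (conv-Xˡ u₀ g n)))

conv-θu₂ : ∀ g n → conv (θ u₂) g n ≡ ⟦ 2 ⟧ * X (conv u₁ g) n
conv-θu₂ g n = trans (conv-congˡ g θu₂ n)
  (trans (conv-*ˡ ⟦ 2 ⟧ (X u₁) g n) (cong (⟦ 2 ⟧ *_) (conv-Xˡ u₁ g n)))

X-cong : ∀ {f g : ℕ → ℚ} → (∀ n → f n ≡ g n) → ∀ n → X f n ≡ X g n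
X-cong f≗g zero    = refl
X-cong f≗g (suc n) = f≗g n

-- θ annihilates the difference, whose constant term vanishes.
u₁u₁≡u₀u₂ : ∀ n → conv u₁ u₁ n ≡ E₂ n
u₁u₁≡u₀u₂ zero    = refl
u₁u₁≡u₀u₂ n@(suc m) = *⟦⟧-cancelʳ n (begin
  conv u₁ u₁ n * ⟦ n ⟧                       ≡⟨ *-comm _ ⟦ n ⟧ ⟩
  θ (conv u₁ u₁) n                           ≡⟨ θ-conv u₁ u₁ n ⟩
  conv (θ u₁) u₁ n + conv u₁ (θ u₁) n        ≡⟨ cong (conv (θ u₁) u₁ n +_) (conv-comm u₁ (θ u₁) n) ⟩
  conv (θ u₁) u₁ n + conv (θ u₁) u₁ n        ≡⟨ cong (λ x → x + x) (trans (conv-θu₁ u₁ n) (cong (_+ E₁ m) (conv-comm u₂ u₁ n))) ⟩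
  (E₃ n + E₁ m) + (E₃ n + E₁ m)              ≡⟨ regroup (E₃ n) (E₁ m) ⟩
  ⟦ 2 ⟧ * E₃ n + ⟦ 2 ⟧ * E₁ m                ≡⟨ cong₂ _+_ (conv-θu₀ u₂ n) (trans (conv-comm u₀ (θ u₂) n) (trans (conv-θu₂ u₀ n) (cong (⟦ 2 ⟧ *_) (conv-comm u₁ u₀ m)))) ⟨
  conv (θ u₀) u₂ n + conv u₀ (θ u₂) n        ≡⟨ θ-conv u₀ u₂ n ⟨
  θ E₂ n                                     ≡⟨ *-comm ⟦ n ⟧ _ ⟩
  E₂ n * ⟦ n ⟧                               ∎)
  where
  regroup : ∀ x y → (x + y) + (x + y) ≡ ⟦ 2 ⟧ * x + ⟦ 2 ⟧ * y
  regroup = solve-∀ ℚ-ring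

θE₀ : ∀ n → θ E₀ n ≡ ⟦ 4 ⟧ * E₁ n
θE₀ n = begin
  θ E₀ n                                ≡⟨ θ-conv u₀ u₀ n ⟩
  conv (θ u₀) u₀ n + conv u₀ (θ u₀) n   ≡⟨ cong (conv (θ u₀) u₀ n +_) (conv-comm u₀ (θ u₀) n) ⟩
  conv (θ u₀) u₀ n + conv (θ u₀) u₀ n   ≡⟨ cong (λ x → x + x) (trans (conv-θu₀ u₀ n) (cong (⟦ 2 ⟧ *_) (conv-comm u₁ u₀ n))) ⟩
  ⟦ 2 ⟧ * E₁ n + ⟦ 2 ⟧ * E₁ n           ≡⟨ double (E₁ n) ⟩
  ⟦ 4 ⟧ * E₁ n                          ∎
  where
  double : ∀ x → ⟦ 2 ⟧ * x + ⟦ 2 ⟧ * x ≡ ⟦ 4 ⟧ * x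
  double = solve-∀ ℚ-ring

θE₁ : ∀ n → θ E₁ n ≡ ⟦ 3 ⟧ * E₂ n + X E₀ n
θE₁ n = begin
  θ E₁ n                                       ≡⟨ θ-conv u₀ u₁ n ⟩
  conv (θ u₀) u₁ n + conv u₀ (θ u₁) n          ≡⟨ cong₂ _+_ (trans (conv-θu₀ u₁ n) (cong (⟦ 2 ⟧ *_) (u₁u₁≡u₀u₂ n))) (trans (conv-comm u₀ (θ u₁) n) (trans (conv-θu₁ u₀ n) (cong (_+ X E₀ n) (conv-comm u₂ u₀ n)))) ⟩
  ⟦ 2 ⟧ * E₂ n + (E₂ n + X E₀ n)               ≡⟨ merge (E₂ n) (X E₀ n) ⟩
  ⟦ 3 ⟧ * E₂ n + X E₀ n                        ∎
  where
  merge : ∀ x y → ⟦ 2 ⟧ * x + (x + y) ≡ ⟦ 3 ⟧ * x + y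
  merge = solve-∀ ℚ-ring

θE₂ : ∀ n → θ E₂ n ≡ ⟦ 2 ⟧ * E₃ n + ⟦ 2 ⟧ * X E₁ n
θE₂ n = trans (θ-conv u₀ u₂ n) (cong₂ _+_ (conv-θu₀ u₂ n)
  (trans (conv-comm u₀ (θ u₂) n) (trans (conv-θu₂ u₀ n) (cong (⟦ 2 ⟧ *_) (X-cong (conv-comm u₁ u₀) n)))))

θE₃ : ∀ n → θ E₃ n ≡ E₄ n + ⟦ 3 ⟧ * X E₂ n
θE₃ n = begin
  θ E₃ n                                       ≡⟨ θ-conv u₁ u₂ n ⟩
  conv (θ u₁) u₂ n + conv u₁ (θ u₂) n          ≡⟨ cong₂ _+_ (conv-θu₁ u₂ n) (trans (conv-comm u₁ (θ u₂) n) (trans (conv-θu₂ u₁ n) (cong (⟦ 2 ⟧ *_) (X-cong u₁u₁≡u₀u₂ n)))) ⟩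
  (E₄ n + X E₂ n) + ⟦ 2 ⟧ * X E₂ n             ≡⟨ merge (E₄ n) (X E₂ n) ⟩
  E₄ n + ⟦ 3 ⟧ * X E₂ n                        ∎
  where
  merge : ∀ x y → (x + y) + ⟦ 2 ⟧ * y ≡ x + ⟦ 3 ⟧ * y
  merge = solve-∀ ℚ-ring

θE₄ : ∀ n → θ E₄ n ≡ ⟦ 4 ⟧ * X E₃ n
θE₄ n = begin
  θ E₄ n                                ≡⟨ θ-conv u₂ u₂ n ⟩
  conv (θ u₂) u₂ n + conv u₂ (θ u₂) n   ≡⟨ cong (conv (θ u₂) u₂ n +_) (conv-comm u₂ (θ u₂) n) ⟩
  conv (θ u₂) u₂ n + conv (θ u₂) u₂ n   ≡⟨ cong (λ x → x + x) (conv-θu₂ u₂ n) ⟩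
  ⟦ 2 ⟧ * X E₃ n + ⟦ 2 ⟧ * X E₃ n       ≡⟨ double (X E₃ n) ⟩
  ⟦ 4 ⟧ * X E₃ n                        ∎
  where
  double : ∀ x → ⟦ 2 ⟧ * x + ⟦ 2 ⟧ * x ≡ ⟦ 4 ⟧ * x
  double = solve-∀ ℚ-ring

-- Nine linear relations at the indices N, N-1 and N-2 contain eight auxiliary unknowns, so one
-- relation between a, b and c survives. The multipliers N⁴, 4N³, 12N², 24N, 24 climb from w⁴ to
-- (θw)⁴ at index N; the remaining four remove what this leaves at N-1 and N-2.
E-elimination : ∀ N a b c E₁ E₁′ E₁″ E₂ E₂′ E₃ E₃′ E₄ →
  N * a ≡ ⟦ 4 ⟧ * E₁ → (N - 1ℚ) * b ≡ ⟦ 4 ⟧ * E₁′ → (N - ⟦ 2 ⟧) * c ≡ ⟦ 4 ⟧ * E₁″ →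
  N * E₁ ≡ ⟦ 3 ⟧ * E₂ + b → (N - 1ℚ) * E₁′ ≡ ⟦ 3 ⟧ * E₂′ + c →
  N * E₂ ≡ ⟦ 2 ⟧ * E₃ + ⟦ 2 ⟧ * E₁′ → (N - 1ℚ) * E₂′ ≡ ⟦ 2 ⟧ * E₃′ + ⟦ 2 ⟧ * E₁″ →
  N * E₃ ≡ E₄ + ⟦ 3 ⟧ * E₂′ → N * E₄ ≡ ⟦ 4 ⟧ * E₃′ →
  N * N * N * N * N * a + ⟦ 64 ⟧ * (N - 1ℚ) * c ≡ ⟦ 2 ⟧ * (⟦ 2 ⟧ * N - 1ℚ) * (⟦ 5 ⟧ * N * (N - 1ℚ) + ⟦ 2 ⟧) * b
E-elimination N a b c E₁ E₁′ E₁″ E₂ E₂′ E₃ E₃′ E₄ q₁ q₂ q₃ q₄ q₅ q₆ q₇ q₈ q₉ = combine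
  (N * N * N * N ⊡ q₁ ⊞ (⟦ 14 ⟧ * N - ⟦ 4 ⟧ - ⟦ 16 ⟧ * N * N) ⊡ q₂ ⊞ ⟦ 24 ⟧ ⊡ q₃
    ⊞ ⟦ 4 ⟧ * N * N * N ⊡ q₄ ⊞ (⟦ 16 ⟧ - ⟦ 40 ⟧ * N) ⊡ q₅ ⊞ ⟦ 12 ⟧ * N * N ⊡ q₆
    ⊞ (- ⟦ 48 ⟧) ⊡ q₇ ⊞ ⟦ 24 ⟧ * N ⊡ q₈ ⊞ ⟦ 24 ⟧ ⊡ q₉)
  (solve (N ∷ a ∷ b ∷ c ∷ E₁ ∷ E₁′ ∷ E₁″ ∷ E₂ ∷ E₂′ ∷ E₃ ∷ E₃′ ∷ E₄ ∷ []) ℚ-ring)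

E₀-recurrence : ∀ n → let N = ⟦ 2 ℕ.+ n ⟧; M = ⟦ 1 ℕ.+ n ⟧ in
  N * N * N * N * N * E₀ (2 ℕ.+ n) + ⟦ 64 ⟧ * M * E₀ n ≡
  ⟦ 2 ⟧ * (⟦ 2 ⟧ * N - 1ℚ) * (⟦ 5 ⟧ * N * M + ⟦ 2 ⟧) * E₀ (1 ℕ.+ n)
E₀-recurrence n = subst
  (λ x → ⟦ N ⟧ * ⟦ N ⟧ * ⟦ N ⟧ * ⟦ N ⟧ * ⟦ N ⟧ * E₀ N + ⟦ 64 ⟧ * x * E₀ n ≡
         ⟦ 2 ⟧ * (⟦ 2 ⟧ * ⟦ N ⟧ - 1ℚ) * (⟦ 5 ⟧ * ⟦ N ⟧ * x + ⟦ 2 ⟧) * E₀ M)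
  N-1≡M
  (E-elimination ⟦ N ⟧ (E₀ N) (E₀ M) (E₀ n) (E₁ N) (E₁ M) (E₁ n) (E₂ N) (E₂ M) (E₃ N) (E₃ M) (E₄ N)
    (θE₀ N) (shift₁ (E₀ M) (θE₀ M)) (trans (cong (_* E₀ n) N-2≡n) (θE₀ n))
    (θE₁ N) (shift₁ (E₁ M) (θE₁ M)) (θE₂ N) (shift₁ (E₂ M) (θE₂ M)) (θE₃ N) (θE₄ N))
  where
  M = 1 ℕ.+ n
  N = 2 ℕ.+ n
  N-1≡M : ⟦ N ⟧ - 1ℚ ≡ ⟦ M ⟧
  N-1≡M = sym (⟦⟧-homo-∸ {N} {1} (s≤s z≤n))
  N-2≡n : ⟦ N ⟧ - ⟦ 2 ⟧ ≡ ⟦ n ⟧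
  N-2≡n = sym (⟦⟧-homo-∸ {N} {2} (s≤s (s≤s z≤n)))
  shift₁ : ∀ x {y} → ⟦ M ⟧ * x ≡ y → (⟦ N ⟧ - 1ℚ) * x ≡ y
  shift₁ x eq = trans (cong (_* x) N-1≡M) eq

-- Factorial form of the Domb numbers and the recurrence of `d`

⟦sum⟧ : ∀ n (f g : ℕ → ℕ) → ⟦ sum (map f (applyUpTo g n)) ⟧ ≡ ∑ n (λ k → ⟦ f (g k) ⟧)
⟦sum⟧ zero    f g = refl
⟦sum⟧ (suc n) f g = trans (⟦⟧-homo-+ (f (g 0)) _) (cong (⟦ f (g 0) ⟧ +_) (⟦sum⟧ n f (g ∘ suc)))

foldr-+≡∑ : ∀ n (f : ℕ → ℚ) (g : ℕ → ℕ) → foldr _+_ 0ℚ (map f (applyUpTo g n)) ≡ ∑ n (f ∘ g)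
foldr-+≡∑ zero    f g = refl
foldr-+≡∑ (suc n) f g = cong (f (g 0) +_) (foldr-+≡∑ n f (g ∘ suc))

C-factorials : ∀ {n k} → k ℕ.≤ n → ⟦ n C k ⟧ * (⟦ k ! ⟧ * ⟦ (n ℕ.∸ k) ! ⟧) ≡ ⟦ n ! ⟧
C-factorials {n} {k} k≤n = begin
  ⟦ n C k ⟧ * (⟦ k ! ⟧ * ⟦ (n ℕ.∸ k) ! ⟧)      ≡⟨ cong (⟦ n C k ⟧ *_) (⟦⟧-homo-* (k !) ((n ℕ.∸ k) !)) ⟨
  ⟦ n C k ⟧ * ⟦ k ! ℕ.* (n ℕ.∸ k) ! ⟧          ≡⟨ ⟦⟧-homo-* (n C k) (k ! ℕ.* (n ℕ.∸ k) !) ⟨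
  ⟦ (n C k) ℕ.* (k ! ℕ.* (n ℕ.∸ k) !) ⟧          ≡⟨ cong ⟦_⟧ exact ⟩
  ⟦ n ! ⟧                                      ∎
  where
  instance _ = k ℕ.!* (n ℕ.∸ k) !≢0
  divides! : k ! ℕ.* (n ℕ.∸ k) ! ∣ n !
  divides! = subst (_∣ n !) (ℕ.*-comm ((n ℕ.∸ k) !) (k !)) ([n∸k]!k!∣n! k≤n)
  exact : (n C k) ℕ.* (k ! ℕ.* (n ℕ.∸ k) !) ≡ n !
  exact = trans (cong (ℕ._* (k ! ℕ.* (n ℕ.∸ k) !)) (nCk≡n!/k![n-k]! k≤n)) (m/n*n≡m divides!)

u₀-factorials : ∀ a → let f = ⟦ a ! ⟧ in u₀ a * (f * f * (f * f)) ≡ ⟦ (2 ℕ.* a) ! ⟧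
u₀-factorials zero    = refl
u₀-factorials (suc a) = begin
  u₀ (suc a) * (f′ * f′ * (f′ * f′))
    ≡⟨ cong (λ x → u₀ (suc a) * (x * x * (x * x))) (⟦⟧-homo-* (suc a) (a !)) ⟩
  u₀ (suc a) * (⟦ suc a ⟧ * f * (⟦ suc a ⟧ * f) * (⟦ suc a ⟧ * f * (⟦ suc a ⟧ * f)))
    ≡⟨ algebra ⟦ a ⟧ f (u₀ a) (u₀ (suc a)) ⟦ (2 ℕ.* a) ! ⟧ (u₀-step a) (u₀-factorials a) ⟩
  (1ℚ + (1ℚ + ⟦ 2 ⟧ * ⟦ a ⟧)) * ((1ℚ + ⟦ 2 ⟧ * ⟦ a ⟧) * ⟦ (2 ℕ.* a) ! ⟧)
    ≡⟨ cong (λ x → (1ℚ + (1ℚ + x)) * ((1ℚ + x) * ⟦ (2 ℕ.* a) ! ⟧)) (⟦⟧-homo-* 2 a) ⟨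
  ⟦ 2 ℕ.+ 2 ℕ.* a ⟧ * (⟦ 1 ℕ.+ 2 ℕ.* a ⟧ * ⟦ (2 ℕ.* a) ! ⟧)
    ≡⟨ cong (⟦ 2 ℕ.+ 2 ℕ.* a ⟧ *_) (⟦⟧-homo-* (1 ℕ.+ 2 ℕ.* a) ((2 ℕ.* a) !)) ⟨
  ⟦ 2 ℕ.+ 2 ℕ.* a ⟧ * ⟦ (1 ℕ.+ 2 ℕ.* a) ! ⟧
    ≡⟨ ⟦⟧-homo-* (2 ℕ.+ 2 ℕ.* a) ((1 ℕ.+ 2 ℕ.* a) !) ⟨
  ⟦ (2 ℕ.+ 2 ℕ.* a) ! ⟧
    ≡⟨ cong (λ n → ⟦ n ! ⟧) (ℕ.*-suc 2 a) ⟨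
  ⟦ (2 ℕ.* suc a) ! ⟧ ∎
  where
  f  = ⟦ a ! ⟧
  f′ = ⟦ suc a ! ⟧
  algebra : ∀ a f u u′ F → u′ * ((1ℚ + a) * (1ℚ + a) * (1ℚ + a)) ≡ ⟦ 2 ⟧ * (⟦ 2 ⟧ * a + 1ℚ) * u →
    u * (f * f * (f * f)) ≡ F →
    u′ * ((1ℚ + a) * f * ((1ℚ + a) * f) * ((1ℚ + a) * f * ((1ℚ + a) * f))) ≡
    (1ℚ + (1ℚ + ⟦ 2 ⟧ * a)) * ((1ℚ + ⟦ 2 ⟧ * a) * F)
  algebra a f u u′ F q₁ q₂ = combine
    ((1ℚ + a) * f * f * f * f ⊡ q₁ ⊞ (1ℚ + (1ℚ + ⟦ 2 ⟧ * a)) * (1ℚ + ⟦ 2 ⟧ * a) ⊡ q₂)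
    (solve (a ∷ f ∷ u ∷ u′ ∷ F ∷ []) ℚ-ring)

central-binomial : ∀ a → ⟦ (2 ℕ.* a) C a ⟧ ≡ u₀ a * (⟦ a ! ⟧ * ⟦ a ! ⟧)
central-binomial a = *⟦⟧-cancelʳ (a !) {{a ℕ.!≢0}} (*⟦⟧-cancelʳ (a !) {{a ℕ.!≢0}} (begin
  ⟦ (2 ℕ.* a) C a ⟧ * f * f            ≡⟨ *-assoc ⟦ (2 ℕ.* a) C a ⟧ f f ⟩
  ⟦ (2 ℕ.* a) C a ⟧ * (f * f)          ≡⟨ cong (λ n → ⟦ (2 ℕ.* a) C a ⟧ * (f * ⟦ n ! ⟧)) 2a∸a≡a ⟨
  ⟦ (2 ℕ.* a) C a ⟧ * (f * ⟦ (2 ℕ.* a ℕ.∸ a) ! ⟧)  ≡⟨ C-factorials (ℕ.m≤m+n a (a ℕ.+ 0)) ⟩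
  ⟦ (2 ℕ.* a) ! ⟧                      ≡⟨ u₀-factorials a ⟨
  u₀ a * (f * f * (f * f))             ≡⟨ regroup (u₀ a) f ⟩
  u₀ a * (f * f) * f * f               ∎))
  where
  f = ⟦ a ! ⟧
  2a∸a≡a : 2 ℕ.* a ℕ.∸ a ≡ a
  2a∸a≡a = trans (ℕ.m+n∸m≡n a (a ℕ.+ 0)) (ℕ.+-identityʳ a)
  regroup : ∀ u f → u * (f * f * (f * f)) ≡ u * (f * f) * f * f
  regroup = solve-∀ ℚ-ring

Domb≡E₀ : ∀ n → ⟦ Domb n ⟧ ≡ ⟦ n ! ⟧ * ⟦ n ! ⟧ * E₀ n
Domb≡E₀ n = begin
  ⟦ Domb n ⟧                                                        ≡⟨ ⟦sum⟧ (suc n) term (λ k → k) ⟩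
  ∑ (suc n) (λ k → ⟦ term k ⟧)                                      ≡⟨ ∑-cong-< (suc n) (λ { k (s≤s k≤n) → ⟦term⟧ k k≤n }) ⟩
  ∑ (suc n) (λ k → ⟦ n ! ⟧ * ⟦ n ! ⟧ * (u₀ k * u₀ (n ℕ.∸ k)))       ≡⟨ ∑-*ˡ (suc n) (⟦ n ! ⟧ * ⟦ n ! ⟧) (λ k → u₀ k * u₀ (n ℕ.∸ k)) ⟩
  ⟦ n ! ⟧ * ⟦ n ! ⟧ * E₀ n                                          ∎
  where
  term : ℕ → ℕ
  term k = (n C k) ℕ.^ 2 ℕ.* ((2 ℕ.* k) C k) ℕ.* ((2 ℕ.* (n ℕ.∸ k)) C (n ℕ.∸ k))

  algebra : ∀ b c x y u v N → c ≡ u * (x * x) → b ≡ v * (y * y) → ∀ a → a * (x * y) ≡ N →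
    a * (a * 1ℚ) * c * b ≡ N * N * (u * v)
  algebra _ _ x y u v _ refl refl a refl = solve (x ∷ y ∷ u ∷ v ∷ a ∷ []) ℚ-ring

  ⟦term⟧ : ∀ k → k ℕ.≤ n → ⟦ term k ⟧ ≡ ⟦ n ! ⟧ * ⟦ n ! ⟧ * (u₀ k * u₀ (n ℕ.∸ k))
  ⟦term⟧ k k≤n = begin
    ⟦ term k ⟧
      ≡⟨ ⟦⟧-homo-* ((n C k) ℕ.^ 2 ℕ.* c) b ⟩
    ⟦ (n C k) ℕ.^ 2 ℕ.* c ⟧ * ⟦ b ⟧
      ≡⟨ cong (_* ⟦ b ⟧) (⟦⟧-homo-* ((n C k) ℕ.^ 2) c) ⟩
    ⟦ (n C k) ℕ.^ 2 ⟧ * ⟦ c ⟧ * ⟦ b ⟧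
      ≡⟨ cong (λ x → x * ⟦ c ⟧ * ⟦ b ⟧) (trans (⟦⟧-homo-* (n C k) _) (cong (⟦ n C k ⟧ *_) (⟦⟧-homo-* (n C k) 1))) ⟩
    ⟦ n C k ⟧ * (⟦ n C k ⟧ * 1ℚ) * ⟦ c ⟧ * ⟦ b ⟧
      ≡⟨ algebra ⟦ b ⟧ ⟦ c ⟧ ⟦ k ! ⟧ ⟦ (n ℕ.∸ k) ! ⟧ (u₀ k) (u₀ (n ℕ.∸ k)) ⟦ n ! ⟧
           (central-binomial k) (central-binomial (n ℕ.∸ k)) ⟦ n C k ⟧ (C-factorials k≤n) ⟩
    ⟦ n ! ⟧ * ⟦ n ! ⟧ * (u₀ k * u₀ (n ℕ.∸ k)) ∎
    where
    c = (2 ℕ.* k) C k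
    b = (2 ℕ.* (n ℕ.∸ k)) C (n ℕ.∸ k)

d : ℕ → ℚ
d n = (ℤ.+ Domb n / 16 ℕ.^ n) {{ℕ.m^n≢0 16 n}}

d-* : ∀ n → d n * ⟦ 16 ℕ.^ n ⟧ ≡ ⟦ Domb n ⟧
d-* n = trans (/-*-cancel (ℤ.+ Domb n) (16 ℕ.^ n) {{ℕ.m^n≢0 16 n}}) (sym (⟦⟧≡/1 (Domb n)))

-- Removing n!² and 16ⁿ turns `E₀-recurrence` into one with coefficients 256 N³, 64 M³ and 32 times
-- the right-hand factor; the common factor 32 is divided out.
d-recurrence : ∀ n → let N = ⟦ 2 ℕ.+ n ⟧; M = ⟦ 1 ℕ.+ n ⟧ in
  ⟦ 8 ⟧ * (N * N * N) * d (2 ℕ.+ n) + ⟦ 2 ⟧ * (M * M * M) * d n ≡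
  (⟦ 2 ⟧ * N - 1ℚ) * (⟦ 5 ⟧ * N * M + ⟦ 2 ⟧) * d (1 ℕ.+ n)
d-recurrence n = *⟦⟧-cancelʳ s {{ℕ.m^n≢0 16 n}}
  (algebra ⟦ N ⟧ ⟦ M ⟧ (⟦ 2 ⟧ * ⟦ N ⟧ - 1ℚ) (⟦ 5 ⟧ * ⟦ N ⟧ * ⟦ M ⟧ + ⟦ 2 ⟧) ⟦ n ! ⟧ ⟦ s ⟧ (d n) (d M) (d N) (E₀ n) (E₀ M) (E₀ N)
    (trans (d-* n) (Domb≡E₀ n))
    (begin
      d M * (⟦ 16 ⟧ * ⟦ s ⟧)                           ≡⟨ cong (d M *_) (⟦⟧-homo-* 16 s) ⟨
      d M * ⟦ 16 ℕ.^ M ⟧                               ≡⟨ trans (d-* M) (Domb≡E₀ M) ⟩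
      ⟦ M ! ⟧ * ⟦ M ! ⟧ * E₀ M                         ≡⟨ cong (λ x → x * x * E₀ M) (⟦⟧-homo-* M (n !)) ⟩
      ⟦ M ⟧ * ⟦ n ! ⟧ * (⟦ M ⟧ * ⟦ n ! ⟧) * E₀ M       ∎)
    (begin
      d N * (⟦ 16 ⟧ * (⟦ 16 ⟧ * ⟦ s ⟧))                ≡⟨ cong (λ x → d N * (⟦ 16 ⟧ * x)) (⟦⟧-homo-* 16 s) ⟨
      d N * (⟦ 16 ⟧ * ⟦ 16 ℕ.* s ⟧)                    ≡⟨ cong (d N *_) (⟦⟧-homo-* 16 (16 ℕ.* s)) ⟨
      d N * ⟦ 16 ℕ.^ N ⟧                               ≡⟨ trans (d-* N) (Domb≡E₀ N) ⟩
      ⟦ N ! ⟧ * ⟦ N ! ⟧ * E₀ N                         ≡⟨ cong (λ x → x * x * E₀ N) (trans (⟦⟧-homo-* N (M !)) (cong (⟦ N ⟧ *_) (⟦⟧-homo-* M (n !)))) ⟩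
      ⟦ N ⟧ * (⟦ M ⟧ * ⟦ n ! ⟧) * (⟦ N ⟧ * (⟦ M ⟧ * ⟦ n ! ⟧)) * E₀ N ∎)
    (E₀-recurrence n))
  where
  M = 1 ℕ.+ n
  N = 2 ℕ.+ n
  s = 16 ℕ.^ n
  algebra : ∀ N M A B f s d d′ d″ e e′ e″ →
    d * s ≡ f * f * e → d′ * (⟦ 16 ⟧ * s) ≡ M * f * (M * f) * e′ →
    d″ * (⟦ 16 ⟧ * (⟦ 16 ⟧ * s)) ≡ N * (M * f) * (N * (M * f)) * e″ →
    N * N * N * N * N * e″ + ⟦ 64 ⟧ * M * e ≡ ⟦ 2 ⟧ * A * B * e′ →
    (⟦ 8 ⟧ * (N * N * N) * d″ + ⟦ 2 ⟧ * (M * M * M) * d) * s ≡ (A * B * d′) * s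
  algebra N M A B f s d d′ d″ e e′ e″ q₀ q₁ q₂ q₃ = combine
    (⟦ 2 ⟧ * M * M * M ⊡ q₀ ⊞ (- (recip 16 * A * B)) ⊡ q₁ ⊞ recip 32 * N * N * N ⊡ q₂ ⊞ recip 32 * M * M * f * f ⊡ q₃)
    (solve (N ∷ M ∷ A ∷ B ∷ f ∷ s ∷ d ∷ d′ ∷ d″ ∷ e ∷ e′ ∷ e″ ∷ []) ℚ-ring)

-- The expansion of Domb n / 16ⁿ

den : ℕ → ℕ
den k = 8 ℕ.* (suc k ℕ.* suc k ℕ.* suc k ℕ.* suc k)

⟦den⟧ : ∀ k → let s = ⟦ suc k ⟧ in ⟦ den k ⟧ ≡ ⟦ 8 ⟧ * (s * s * s * s)
⟦den⟧ k = trans (⟦⟧-homo-* 8 (s ℕ.* s ℕ.* s ℕ.* s)) (cong (⟦ 8 ⟧ *_)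
  (trans (⟦⟧-homo-* (s ℕ.* s ℕ.* s) s) (cong (_* ⟦ s ⟧)
    (trans (⟦⟧-homo-* (s ℕ.* s) s) (cong (_* ⟦ s ⟧) (⟦⟧-homo-* s s))))))
  where
  s = suc k

hyp-den-step : ∀ num k → let s = ⟦ suc k ⟧ in
  hyp num den (suc k) * (⟦ 8 ⟧ * (s * s * s * s)) ≡ num k * hyp num den k
hyp-den-step num k = trans (cong (hyp num den (suc k) *_) (sym (⟦den⟧ k))) (hyp-step num den k)

-- The upper index is a rational `x`, so the shifts to x-1 and x-2 involve no truncated subtraction.
-- At `x = ⟦ n ⟧` the factor `x - k` of `t-num` and `h-num` makes the series terminate.
t-num h-num z-num : ℚ → ℕ → ℚ
t-num x k = - ((x + ⟦ 2 ⟧ * ⟦ k ⟧ + 1ℚ) * (x + ⟦ 2 ⟧ * ⟦ k ⟧ + ⟦ 2 ⟧) * (x - ⟦ k ⟧) * (⟦ 2 ⟧ * ⟦ k ⟧ + 1ℚ))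
h-num x k = - ((x + ⟦ 2 ⟧ * ⟦ k ⟧) * (x + ⟦ 2 ⟧ * ⟦ k ⟧ - 1ℚ) * (x - ⟦ k ⟧) * (⟦ 2 ⟧ * ⟦ k ⟧ + 1ℚ))
z-num x k = - ((x + ⟦ 2 ⟧ * ⟦ k ⟧ + 1ℚ) * (x + ⟦ 2 ⟧ * ⟦ k ⟧ + ⟦ 2 ⟧) * (x - ⟦ k ⟧ - 1ℚ) * (⟦ 2 ⟧ * ⟦ k ⟧ + 1ℚ))

-- t n k = C(n+2k,3k) C(2k,k)² C(3k,k) / (-16)ᵏ
t h z : ℚ → ℕ → ℚ
t x = hyp (t-num x) den
h x = hyp (h-num x) den
z x = hyp (z-num x) den

t-vanish : ∀ {n k} → n ℕ.< k → t ⟦ n ⟧ k ≡ 0ℚ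
t-vanish {n} = hyp-vanish (t-num ⟦ n ⟧) den (root ⟦ n ⟧)
  where
  root : ∀ x → - ((x + ⟦ 2 ⟧ * x + 1ℚ) * (x + ⟦ 2 ⟧ * x + ⟦ 2 ⟧) * (x - x) * (⟦ 2 ⟧ * x + 1ℚ)) ≡ 0ℚ
  root = solve-∀ ℚ-ring

h-vanish : ∀ {n k} → n ℕ.< k → h ⟦ n ⟧ k ≡ 0ℚ
h-vanish {n} = hyp-vanish (h-num ⟦ n ⟧) den (root ⟦ n ⟧)
  where
  root : ∀ x → - ((x + ⟦ 2 ⟧ * x) * (x + ⟦ 2 ⟧ * x - 1ℚ) * (x - x) * (⟦ 2 ⟧ * x + 1ℚ)) ≡ 0ℚ
  root = solve-∀ ℚ-ring

-- h is the common factor of t x, t (x-1) and t (x-2), up to x (x-1).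
t≡h₀ : ∀ x k → x * (x - 1ℚ) * t x k ≡ (x + ⟦ 2 ⟧ * ⟦ k ⟧) * (x + ⟦ 2 ⟧ * ⟦ k ⟧ - 1ℚ) * h x k
t≡h₀ x = hyp-compare (t-num x) (h-num x) den
  (λ _ → x * (x - 1ℚ)) (λ k → (x + ⟦ 2 ⟧ * ⟦ k ⟧) * (x + ⟦ 2 ⟧ * ⟦ k ⟧ - 1ℚ)) (t-num x)
  (base x) (λ k → *-comm _ (t-num x k)) (λ k → step x ⟦ k ⟧)
  where
  base : ∀ x → x * (x - 1ℚ) ≡ (x + ⟦ 2 ⟧ * 0ℚ) * (x + ⟦ 2 ⟧ * 0ℚ - 1ℚ)
  base = solve-∀ ℚ-ring
  step : ∀ x k → (x + ⟦ 2 ⟧ * (1ℚ + k)) * (x + ⟦ 2 ⟧ * (1ℚ + k) - 1ℚ) * (- ((x + ⟦ 2 ⟧ * k) * (x + ⟦ 2 ⟧ * k - 1ℚ) * (x - k) * (⟦ 2 ⟧ * k + 1ℚ)))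
    ≡ - ((x + ⟦ 2 ⟧ * k + 1ℚ) * (x + ⟦ 2 ⟧ * k + ⟦ 2 ⟧) * (x - k) * (⟦ 2 ⟧ * k + 1ℚ)) * ((x + ⟦ 2 ⟧ * k) * (x + ⟦ 2 ⟧ * k - 1ℚ))
  step = solve-∀ ℚ-ring

t≡h₁ : ∀ x k → x * (x - 1ℚ) * t (x - 1ℚ) k ≡ (x + ⟦ 2 ⟧ * ⟦ k ⟧ - 1ℚ) * (x - ⟦ k ⟧) * h x k
t≡h₁ x = hyp-compare (t-num (x - 1ℚ)) (h-num x) den
  (λ _ → x * (x - 1ℚ)) (λ k → (x + ⟦ 2 ⟧ * ⟦ k ⟧ - 1ℚ) * (x - ⟦ k ⟧)) (t-num (x - 1ℚ))
  (base x) (λ k → *-comm _ (t-num (x - 1ℚ) k)) (λ k → step x ⟦ k ⟧)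
  where
  base : ∀ x → x * (x - 1ℚ) ≡ (x + ⟦ 2 ⟧ * 0ℚ - 1ℚ) * (x - 0ℚ)
  base = solve-∀ ℚ-ring
  step : ∀ x k → (x + ⟦ 2 ⟧ * (1ℚ + k) - 1ℚ) * (x - (1ℚ + k)) * (- ((x + ⟦ 2 ⟧ * k) * (x + ⟦ 2 ⟧ * k - 1ℚ) * (x - k) * (⟦ 2 ⟧ * k + 1ℚ)))
    ≡ - ((x - 1ℚ + ⟦ 2 ⟧ * k + 1ℚ) * (x - 1ℚ + ⟦ 2 ⟧ * k + ⟦ 2 ⟧) * (x - 1ℚ - k) * (⟦ 2 ⟧ * k + 1ℚ)) * ((x + ⟦ 2 ⟧ * k - 1ℚ) * (x - k))
  step = solve-∀ ℚ-ring

t≡h₂ : ∀ x k → x * (x - 1ℚ) * t (x - ⟦ 2 ⟧) k ≡ (x - ⟦ k ⟧) * (x - ⟦ k ⟧ - 1ℚ) * h x k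
t≡h₂ x = hyp-compare (t-num (x - ⟦ 2 ⟧)) (h-num x) den
  (λ _ → x * (x - 1ℚ)) (λ k → (x - ⟦ k ⟧) * (x - ⟦ k ⟧ - 1ℚ)) (t-num (x - ⟦ 2 ⟧))
  (base x) (λ k → *-comm _ (t-num (x - ⟦ 2 ⟧) k)) (λ k → step x ⟦ k ⟧)
  where
  base : ∀ x → x * (x - 1ℚ) ≡ (x - 0ℚ) * (x - 0ℚ - 1ℚ)
  base = solve-∀ ℚ-ring
  step : ∀ x k → (x - (1ℚ + k)) * (x - (1ℚ + k) - 1ℚ) * (- ((x + ⟦ 2 ⟧ * k) * (x + ⟦ 2 ⟧ * k - 1ℚ) * (x - k) * (⟦ 2 ⟧ * k + 1ℚ)))
    ≡ - ((x - ⟦ 2 ⟧ + ⟦ 2 ⟧ * k + 1ℚ) * (x - ⟦ 2 ⟧ + ⟦ 2 ⟧ * k + ⟦ 2 ⟧) * (x - ⟦ 2 ⟧ - k) * (⟦ 2 ⟧ * k + 1ℚ)) * ((x - k) * (x - k - 1ℚ))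
  step = solve-∀ ℚ-ring

-- Creative telescoping: the operator of `d-recurrence`, applied to the summand in the parameter x,
-- is a difference in k. The k⁴ in the certificate `G` cancels the denominator of the next ratio of
-- `h`, and 24 is 3 times the 8 of `den`. Once everything is a multiple of `h x k`, a polynomial
-- identity remains.
t-telescopes : ∀ x k → let y = x - 1ℚ; G = λ k → - (⟦ 24 ⟧ * (⟦ 3 ⟧ * x - 1ℚ) * (⟦ k ⟧ * ⟦ k ⟧ * ⟦ k ⟧ * ⟦ k ⟧) * h x k) in
  x * y * (⟦ 8 ⟧ * (x * x * x) * t x k + ⟦ 2 ⟧ * (y * y * y) * t (x - ⟦ 2 ⟧) k
    - (⟦ 2 ⟧ * x - 1ℚ) * (⟦ 5 ⟧ * x * y + ⟦ 2 ⟧) * t y k) ≡ G (suc k) - G k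
t-telescopes x k = algebra x ⟦ k ⟧ (t x k) (t (x - 1ℚ) k) (t (x - ⟦ 2 ⟧) k) (h x k) (h x (suc k))
  (t≡h₀ x k) (t≡h₁ x k) (t≡h₂ x k) (hyp-den-step (h-num x) k)
  where
  algebra : ∀ x k a b c e e′ →
    x * (x - 1ℚ) * a ≡ (x + ⟦ 2 ⟧ * k) * (x + ⟦ 2 ⟧ * k - 1ℚ) * e →
    x * (x - 1ℚ) * b ≡ (x + ⟦ 2 ⟧ * k - 1ℚ) * (x - k) * e →
    x * (x - 1ℚ) * c ≡ (x - k) * (x - k - 1ℚ) * e →
    e′ * (⟦ 8 ⟧ * ((1ℚ + k) * (1ℚ + k) * (1ℚ + k) * (1ℚ + k))) ≡ - ((x + ⟦ 2 ⟧ * k) * (x + ⟦ 2 ⟧ * k - 1ℚ) * (x - k) * (⟦ 2 ⟧ * k + 1ℚ)) * e →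
    let y = x - 1ℚ in
    x * y * (⟦ 8 ⟧ * (x * x * x) * a + ⟦ 2 ⟧ * (y * y * y) * c - (⟦ 2 ⟧ * x - 1ℚ) * (⟦ 5 ⟧ * x * y + ⟦ 2 ⟧) * b)
    ≡ - (⟦ 24 ⟧ * (⟦ 3 ⟧ * x - 1ℚ) * ((1ℚ + k) * (1ℚ + k) * (1ℚ + k) * (1ℚ + k)) * e′) - - (⟦ 24 ⟧ * (⟦ 3 ⟧ * x - 1ℚ) * (k * k * k * k) * e)
  algebra x k a b c e e′ q₀ q₁ q₂ q₃ = combine
    (⟦ 8 ⟧ * (x * x * x) ⊡ q₀ ⊞ (- ((⟦ 2 ⟧ * x - 1ℚ) * (⟦ 5 ⟧ * x * (x - 1ℚ) + ⟦ 2 ⟧))) ⊡ q₁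
      ⊞ ⟦ 2 ⟧ * ((x - 1ℚ) * (x - 1ℚ) * (x - 1ℚ)) ⊡ q₂ ⊞ ⟦ 3 ⟧ * (⟦ 3 ⟧ * x - 1ℚ) ⊡ q₃)
    (solve (x ∷ k ∷ a ∷ b ∷ c ∷ e ∷ e′ ∷ []) ℚ-ring)

T : ℕ → ℚ → ℚ
T K x = ∑ K (t x)

T-telescoped : ∀ K x → let y = x - 1ℚ in
  x * y * (⟦ 8 ⟧ * (x * x * x) * T K x + ⟦ 2 ⟧ * (y * y * y) * T K (x - ⟦ 2 ⟧)
    - (⟦ 2 ⟧ * x - 1ℚ) * (⟦ 5 ⟧ * x * y + ⟦ 2 ⟧) * T K y)
  ≡ - (⟦ 24 ⟧ * (⟦ 3 ⟧ * x - 1ℚ) * (⟦ K ⟧ * ⟦ K ⟧ * ⟦ K ⟧ * ⟦ K ⟧) * h x K)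
T-telescoped K x = begin
  x * y * (A * T K x + B * T K w - Q * T K y)
    ≡⟨ cong₂ (λ a b → x * y * (a - b)) (cong₂ _+_ (∑-*ˡ K A (t x)) (∑-*ˡ K B (t w))) (∑-*ˡ K Q (t y)) ⟨
  x * y * (∑ K (λ k → A * t x k) + ∑ K (λ k → B * t w k) - ∑ K (λ k → Q * t y k))
    ≡⟨ cong₂ (λ a b → x * y * (a + b)) (∑-+ K (λ k → A * t x k) (λ k → B * t w k)) (∑-neg K (λ k → Q * t y k)) ⟨
  x * y * (∑ K (λ k → A * t x k + B * t w k) + ∑ K (λ k → - (Q * t y k)))
    ≡⟨ cong (x * y *_) (∑-+ K (λ k → A * t x k + B * t w k) (λ k → - (Q * t y k))) ⟨
  x * y * ∑ K (λ k → A * t x k + B * t w k - Q * t y k)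
    ≡⟨ ∑-*ˡ K (x * y) (λ k → A * t x k + B * t w k - Q * t y k) ⟨
  ∑ K (λ k → x * y * (A * t x k + B * t w k - Q * t y k))
    ≡⟨ ∑-telescope K G (t-telescopes x) ⟩
  G K - G 0
    ≡⟨ drop (⟦ 24 ⟧ * (⟦ 3 ⟧ * x - 1ℚ)) (G K) ⟩
  G K ∎
  where
  y = x - 1ℚ
  w = x - ⟦ 2 ⟧
  A = ⟦ 8 ⟧ * (x * x * x)
  B = ⟦ 2 ⟧ * (y * y * y)
  Q = (⟦ 2 ⟧ * x - 1ℚ) * (⟦ 5 ⟧ * x * y + ⟦ 2 ⟧)
  G : ℕ → ℚ
  G k = - (⟦ 24 ⟧ * (⟦ 3 ⟧ * x - 1ℚ) * (⟦ k ⟧ * ⟦ k ⟧ * ⟦ k ⟧ * ⟦ k ⟧) * h x k)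
  drop : ∀ a g → g - - (a * 0ℚ * 1ℚ) ≡ g
  drop = solve-∀ ℚ-ring

-- The truncation error in `T-telescoped` is a multiple of `h N K`, which vanishes for N < K.
-- Starting at index 2 makes the prefactor x(x-1) nonzero, so it cancels.
T-recurrence : ∀ K n → 2 ℕ.+ n ℕ.< K → let N = ⟦ 2 ℕ.+ n ⟧; M = ⟦ 1 ℕ.+ n ⟧ in
  ⟦ 8 ⟧ * (N * N * N) * T K N + ⟦ 2 ⟧ * (M * M * M) * T K ⟦ n ⟧ ≡
  (⟦ 2 ⟧ * N - 1ℚ) * (⟦ 5 ⟧ * N * M + ⟦ 2 ⟧) * T K M
T-recurrence K n N<K = subst₂
  (λ m l → ⟦ 8 ⟧ * (⟦ N ⟧ * ⟦ N ⟧ * ⟦ N ⟧) * T K ⟦ N ⟧ + ⟦ 2 ⟧ * (m * m * m) * T K l ≡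
           (⟦ 2 ⟧ * ⟦ N ⟧ - 1ℚ) * (⟦ 5 ⟧ * ⟦ N ⟧ * m + ⟦ 2 ⟧) * T K m)
  (sym (⟦⟧-homo-∸ {N} {1} (s≤s z≤n))) (sym (⟦⟧-homo-∸ {N} {2} (s≤s (s≤s z≤n))))
  (a-b≡0⇒a≡b (*⟦⟧-cancelʳ N (*⟦⟧-cancelʳ (suc n) (trans reorder vanish))))
  where
  N = 2 ℕ.+ n
  y = ⟦ N ⟧ - 1ℚ
  L = ⟦ 8 ⟧ * (⟦ N ⟧ * ⟦ N ⟧ * ⟦ N ⟧) * T K ⟦ N ⟧ + ⟦ 2 ⟧ * (y * y * y) * T K (⟦ N ⟧ - ⟦ 2 ⟧)
  R = (⟦ 2 ⟧ * ⟦ N ⟧ - 1ℚ) * (⟦ 5 ⟧ * ⟦ N ⟧ * y + ⟦ 2 ⟧) * T K y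
  a-b≡0⇒a≡b : ∀ {a b} → a - b ≡ 0ℚ → a ≡ b
  a-b≡0⇒a≡b {a} {b} eq = combine eq (solve (a ∷ b ∷ []) ℚ-ring)
  swap : ∀ x m d → d * x * m ≡ x * m * d
  swap = solve-∀ ℚ-ring
  reorder : (L - R) * ⟦ N ⟧ * ⟦ suc n ⟧ ≡ ⟦ N ⟧ * y * (L - R)
  reorder = trans (swap ⟦ N ⟧ ⟦ suc n ⟧ (L - R)) (cong (λ m → ⟦ N ⟧ * m * (L - R)) (⟦⟧-homo-∸ {N} {1} (s≤s z≤n)))
  zeros : ∀ c a b → - (c * 0ℚ) ≡ 0ℚ * a * b
  zeros = solve-∀ ℚ-ring
  vanish : ⟦ N ⟧ * y * (L - R) ≡ 0ℚ * ⟦ N ⟧ * ⟦ suc n ⟧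
  vanish = trans (T-telescoped K ⟦ N ⟧)
    (trans (cong (λ e → - (⟦ 24 ⟧ * (⟦ 3 ⟧ * ⟦ N ⟧ - 1ℚ) * (⟦ K ⟧ * ⟦ K ⟧ * ⟦ K ⟧ * ⟦ K ⟧) * e)) (h-vanish N<K))
      (zeros (⟦ 24 ⟧ * (⟦ 3 ⟧ * ⟦ N ⟧ - 1ℚ) * (⟦ K ⟧ * ⟦ K ⟧ * ⟦ K ⟧ * ⟦ K ⟧)) ⟦ N ⟧ ⟦ suc n ⟧))

∑-vanish : ∀ n {f : ℕ → ℚ} → (∀ k → f k ≡ 0ℚ) → ∑ n f ≡ 0ℚ
∑-vanish n f≡0 = trans (∑-cong n f≡0) (∑-zero n)

-- Two solutions of the same second-order recurrence with initial values 1 and 1/4; the induction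
-- carries consecutive pairs, and N³ is cancelled at each step.
T≡d : ∀ K n → suc n ℕ.< K → T K ⟦ n ⟧ ≡ d n × T K ⟦ suc n ⟧ ≡ d (suc n)
T≡d (suc (suc K)) zero _ =
  cong (1ℚ +_) (∑-vanish (suc K) {λ k → t 0ℚ (suc k)} (λ k → t-vanish {0} {suc k} z<s)) ,
  cong (λ x → 1ℚ + (t ⟦ 1 ⟧ 1 + x)) (∑-vanish K {λ k → t ⟦ 1 ⟧ (2 ℕ.+ k)} (λ k → t-vanish {1} {2 ℕ.+ k} (s<s z<s)))
T≡d (suc zero) zero (s≤s ())
T≡d K (suc n) N<K = proj₂ ih , *⟦⟧-cancelʳ (N ℕ.* N ℕ.* N) (trans (cong (T K ⟦ N ⟧ *_) cube)
    (trans (algebra (⟦ N ⟧ * ⟦ N ⟧ * ⟦ N ⟧) (⟦ 2 ⟧ * (⟦ M ⟧ * ⟦ M ⟧ * ⟦ M ⟧)) ((⟦ 2 ⟧ * ⟦ N ⟧ - 1ℚ) * (⟦ 5 ⟧ * ⟦ N ⟧ * ⟦ M ⟧ + ⟦ 2 ⟧))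
      (T K ⟦ N ⟧) (d M) (d n) (d N) (T-recurrence K n N<K) (d-recurrence n) (proj₁ ih) (proj₂ ih))
      (cong (d N *_) (sym cube))))
  where
  N = 2 ℕ.+ n
  M = 1 ℕ.+ n
  ih = T≡d K n (ℕ.<-trans (ℕ.n<1+n _) N<K)
  cube : ⟦ N ℕ.* N ℕ.* N ⟧ ≡ ⟦ N ⟧ * ⟦ N ⟧ * ⟦ N ⟧
  cube = trans (⟦⟧-homo-* (N ℕ.* N) N) (cong (_* ⟦ N ⟧) (⟦⟧-homo-* N N))
  algebra : ∀ A B Q a b c d {b′ c′} → ⟦ 8 ⟧ * A * a + B * c′ ≡ Q * b′ → ⟦ 8 ⟧ * A * d + B * c ≡ Q * b →
    c′ ≡ c → b′ ≡ b → a * A ≡ d * A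
  algebra A B Q a b c d q₁ q₂ refl refl = combine (recip 8 ⊡ q₁ ⊞ (- recip 8) ⊡ q₂) (solve (A ∷ B ∷ Q ∷ a ∷ b ∷ c ∷ d ∷ []) ℚ-ring)

-- Summation over n with weight 3n+1

t-shift : ∀ x k → (1ℚ + x - ⟦ k ⟧) * t (1ℚ + x) k ≡ (1ℚ + x + ⟦ 2 ⟧ * ⟦ k ⟧) * t x k
t-shift x = hyp-compare (t-num (1ℚ + x)) (t-num x) den
  (λ k → 1ℚ + x - ⟦ k ⟧) (λ k → 1ℚ + x + ⟦ 2 ⟧ * ⟦ k ⟧)
  (λ k → - ((x + ⟦ 2 ⟧ * ⟦ k ⟧ + ⟦ 2 ⟧) * (x + ⟦ 2 ⟧ * ⟦ k ⟧ + ⟦ 3 ⟧) * (x - ⟦ k ⟧) * (⟦ 2 ⟧ * ⟦ k ⟧ + 1ℚ)))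
  (base x) (λ k → step x ⟦ k ⟧) (λ k → step′ x ⟦ k ⟧)
  where
  base : ∀ x → 1ℚ + x - 0ℚ ≡ 1ℚ + x + ⟦ 2 ⟧ * 0ℚ
  base = solve-∀ ℚ-ring
  step : ∀ x k → (1ℚ + x - (1ℚ + k)) * - ((1ℚ + x + ⟦ 2 ⟧ * k + 1ℚ) * (1ℚ + x + ⟦ 2 ⟧ * k + ⟦ 2 ⟧) * (1ℚ + x - k) * (⟦ 2 ⟧ * k + 1ℚ))
    ≡ - ((x + ⟦ 2 ⟧ * k + ⟦ 2 ⟧) * (x + ⟦ 2 ⟧ * k + ⟦ 3 ⟧) * (x - k) * (⟦ 2 ⟧ * k + 1ℚ)) * (1ℚ + x - k)
  step = solve-∀ ℚ-ring
  step′ : ∀ x k → (1ℚ + x + ⟦ 2 ⟧ * (1ℚ + k)) * - ((x + ⟦ 2 ⟧ * k + 1ℚ) * (x + ⟦ 2 ⟧ * k + ⟦ 2 ⟧) * (x - k) * (⟦ 2 ⟧ * k + 1ℚ))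
    ≡ - ((x + ⟦ 2 ⟧ * k + ⟦ 2 ⟧) * (x + ⟦ 2 ⟧ * k + ⟦ 3 ⟧) * (x - k) * (⟦ 2 ⟧ * k + 1ℚ)) * (1ℚ + x + ⟦ 2 ⟧ * k)
  step′ = solve-∀ ℚ-ring

-- The left side occurs in `V-closed`; the right side displays its factor p at x = p.
t≡z : ∀ x k → (x - ⟦ k ⟧) * t x k ≡ x * z x k
t≡z x = hyp-compare (t-num x) (z-num x) den (λ k → x - ⟦ k ⟧) (λ _ → x) (z-num x)
  (+-identityʳ x) (λ k → step x ⟦ k ⟧) (λ k → *-comm x (z-num x k))
  where
  step : ∀ x k → (x - (1ℚ + k)) * - ((x + ⟦ 2 ⟧ * k + 1ℚ) * (x + ⟦ 2 ⟧ * k + ⟦ 2 ⟧) * (x - k) * (⟦ 2 ⟧ * k + 1ℚ))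
    ≡ - ((x + ⟦ 2 ⟧ * k + 1ℚ) * (x + ⟦ 2 ⟧ * k + ⟦ 2 ⟧) * (x - k - 1ℚ) * (⟦ 2 ⟧ * k + 1ℚ)) * (x - k)
  step = solve-∀ ℚ-ring

V : ℕ → ℕ → ℚ
V N k = ∑ N (λ n → (⟦ 3 ⟧ * ⟦ n ⟧ + 1ℚ) * t ⟦ n ⟧ k)

-- By `t-shift`, the increment of the right side in N is `t N k` times (3N+2)(N+1+2k) - (3N-1)(N-k),
-- and this factors as (3N+1)(3k+2).
V-closed : ∀ N k → (⟦ 3 ⟧ * ⟦ k ⟧ + ⟦ 2 ⟧) * V N k ≡ (⟦ 3 ⟧ * ⟦ N ⟧ - 1ℚ) * ((⟦ N ⟧ - ⟦ k ⟧) * t ⟦ N ⟧ k)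
V-closed zero    zero    = refl
V-closed zero    (suc k) = trans (*-zeroʳ (⟦ 3 ⟧ * ⟦ suc k ⟧ + ⟦ 2 ⟧)) (sym (trans
  (cong (λ e → (⟦ 3 ⟧ * 0ℚ - 1ℚ) * ((0ℚ - ⟦ suc k ⟧) * e)) (t-vanish {0} {suc k} z<s)) (zeros ⟦ suc k ⟧)))
  where
  zeros : ∀ k → (⟦ 3 ⟧ * 0ℚ - 1ℚ) * ((0ℚ - k) * 0ℚ) ≡ 0ℚ
  zeros = solve-∀ ℚ-ring
V-closed (suc N) k = trans
  (cong ((⟦ 3 ⟧ * ⟦ k ⟧ + ⟦ 2 ⟧) *_) (∑-last N (λ n → (⟦ 3 ⟧ * ⟦ n ⟧ + 1ℚ) * t ⟦ n ⟧ k)))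
  (algebra ⟦ N ⟧ ⟦ k ⟧ (V N k) (t ⟦ N ⟧ k) (t ⟦ suc N ⟧ k) (V-closed N k) (t-shift ⟦ N ⟧ k))
  where
  algebra : ∀ N k v a b → (⟦ 3 ⟧ * k + ⟦ 2 ⟧) * v ≡ (⟦ 3 ⟧ * N - 1ℚ) * ((N - k) * a) →
    (1ℚ + N - k) * b ≡ (1ℚ + N + ⟦ 2 ⟧ * k) * a →
    (⟦ 3 ⟧ * k + ⟦ 2 ⟧) * (v + (⟦ 3 ⟧ * N + 1ℚ) * a) ≡ (⟦ 3 ⟧ * (1ℚ + N) - 1ℚ) * ((1ℚ + N - k) * b)
  algebra N k v a b q₁ q₂ = combine (q₁ ⊞ (- (⟦ 3 ⟧ * (1ℚ + N) - 1ℚ)) ⊡ q₂) (solve (N ∷ k ∷ v ∷ a ∷ b ∷ []) ℚ-ring)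

W : ℕ → ℚ
W N = ∑ N (λ n → (⟦ 3 ⟧ * ⟦ n ⟧ + 1ℚ) * d n)

-- Every `d n` with n < N is expanded with the same cut-off N, so the double sum runs over a square.
-- The second component of `T≡d` is what reaches n = N-1.
W≡∑V : ∀ N → 1 ℕ.< N → W N ≡ ∑ N (V N)
W≡∑V N 1<N = trans (∑-cong-< N expand) (∑-swap N N (λ n k → (⟦ 3 ⟧ * ⟦ n ⟧ + 1ℚ) * t ⟦ n ⟧ k))
  where
  d≡T : ∀ n → n ℕ.< N → d n ≡ T N ⟦ n ⟧
  d≡T zero    _   = sym (proj₁ (T≡d N 0 1<N))
  d≡T (suc n) n<N = sym (proj₂ (T≡d N n n<N))
  expand : ∀ n → n ℕ.< N → (⟦ 3 ⟧ * ⟦ n ⟧ + 1ℚ) * d n ≡ ∑ N (λ k → (⟦ 3 ⟧ * ⟦ n ⟧ + 1ℚ) * t ⟦ n ⟧ k)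
  expand n n<N = trans (cong ((⟦ 3 ⟧ * ⟦ n ⟧ + 1ℚ) *_) (d≡T n n<N)) (sym (∑-*ˡ N (⟦ 3 ⟧ * ⟦ n ⟧ + 1ℚ) (t ⟦ n ⟧)))

-- Telescoping the original sum

summand-formula : ∀ m → let n = 2 ℕ.+ m in
  summand n ≡ ⟦ suc n ⟧ * ⟦ suc n ⟧ * recip (suc m) * recip n * d n
summand-formula m = cong (_* d n) (algebra ⟦ n ⟧ ⟦ suc m ⟧ (recip (suc m)) (recip n) q ⟦ suc n ⟧
  (recip-inverseˡ (suc m)) (recip-inverseˡ n) (begin
    q * (⟦ n ⟧ * ⟦ suc m ⟧)             ≡⟨ cong (q *_) (⟦⟧-homo-* n (suc m)) ⟨
    q * ⟦ n ℕ.* suc m ⟧                 ≡⟨ /-*-cancel (ℤ.+ ((n ℕ.+ 1) ℕ.^ 2)) (n ℕ.* suc m) ⟩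
    ℤ.+ ((n ℕ.+ 1) ℕ.^ 2) / 1           ≡⟨ ⟦⟧≡/1 ((n ℕ.+ 1) ℕ.^ 2) ⟨
    ⟦ (n ℕ.+ 1) ℕ.^ 2 ⟧                 ≡⟨ cong ⟦_⟧ (cong₂ ℕ._*_ (ℕ.+-comm n 1) (trans (ℕ.*-identityʳ (n ℕ.+ 1)) (ℕ.+-comm n 1))) ⟩
    ⟦ suc n ℕ.* suc n ⟧                 ≡⟨ ⟦⟧-homo-* (suc n) (suc n) ⟩
    ⟦ suc n ⟧ * ⟦ suc n ⟧               ∎))
  where
  n = 2 ℕ.+ m
  q = ℤ.+ ((n ℕ.+ 1) ℕ.^ 2) / (n ℕ.* suc m)
  algebra : ∀ N M r r′ q L → r * M ≡ 1ℚ → r′ * N ≡ 1ℚ → q * (N * M) ≡ L * L → q ≡ L * L * r * r′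
  algebra N M r r′ q L q₁ q₂ q₃ = combine (r * r′ ⊡ q₃ ⊞ (- (q * r′ * N)) ⊡ q₁ ⊞ (- q) ⊡ q₂)
    (solve (N ∷ M ∷ r ∷ r′ ∷ q ∷ L ∷ []) ℚ-ring)

-- Adding d-recurrence times 1/(2(n-1)) replaces the weight (n+1)²/(n(n-1)) of d n by (3n+1)/2, up to boundary terms.
sum-telescoped : ∀ n → let N = ⟦ 2 ℕ.+ n ⟧ in
  ⟦ 2 ⟧ * ∑ n (λ m → summand (2 ℕ.+ m)) ≡
  ⟦ 3 ⟧ + W (2 ℕ.+ n) + ⟦ 2 ⟧ * (N * N) * d (suc n) - ⟦ 8 ⟧ * (N * N * N) * d (2 ℕ.+ n) * recip (suc n)
-- The empty sum fixes the constant 3: with `d 0 = 1`, `d 1 = 1/4` and `d 2 = 7/64` the right side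
-- is 3 + 2 + 2 - 7.
sum-telescoped zero    = refl
sum-telescoped (suc n) = begin
  ⟦ 2 ⟧ * ∑ (suc n) (λ m → summand (2 ℕ.+ m))
    ≡⟨ cong (⟦ 2 ⟧ *_) (∑-last n (λ m → summand (2 ℕ.+ m))) ⟩
  ⟦ 2 ⟧ * (∑ n (λ m → summand (2 ℕ.+ m)) + summand N)
    ≡⟨ algebra ⟦ suc n ⟧ (recip (suc n)) (recip N) (d (suc n)) (d N) (d (suc N)) (∑ n (λ m → summand (2 ℕ.+ m))) (W N) (summand N)
         (recip-inverseˡ (suc n)) (recip-inverseˡ N) (d-recurrence (suc n)) (summand-formula n) (sum-telescoped n) ⟩
  ⟦ 3 ⟧ + (W N + (⟦ 3 ⟧ * ⟦ N ⟧ + 1ℚ) * d N) + ⟦ 2 ⟧ * (⟦ suc N ⟧ * ⟦ suc N ⟧) * d N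
    - ⟦ 8 ⟧ * (⟦ suc N ⟧ * ⟦ suc N ⟧ * ⟦ suc N ⟧) * d (suc N) * recip N
    ≡⟨ cong (λ w → ⟦ 3 ⟧ + w + ⟦ 2 ⟧ * (⟦ suc N ⟧ * ⟦ suc N ⟧) * d N - ⟦ 8 ⟧ * (⟦ suc N ⟧ * ⟦ suc N ⟧ * ⟦ suc N ⟧) * d (suc N) * recip N)
         (∑-last N (λ n → (⟦ 3 ⟧ * ⟦ n ⟧ + 1ℚ) * d n)) ⟨
  ⟦ 3 ⟧ + W (suc N) + ⟦ 2 ⟧ * (⟦ suc N ⟧ * ⟦ suc N ⟧) * d N
    - ⟦ 8 ⟧ * (⟦ suc N ⟧ * ⟦ suc N ⟧ * ⟦ suc N ⟧) * d (suc N) * recip N ∎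
  where
  N = 2 ℕ.+ n
  algebra : ∀ M r r′ a b c S w σ → let N = 1ℚ + M; L = 1ℚ + N in
    r * M ≡ 1ℚ → r′ * N ≡ 1ℚ →
    ⟦ 8 ⟧ * (L * L * L) * c + ⟦ 2 ⟧ * (N * N * N) * a ≡ (⟦ 2 ⟧ * L - 1ℚ) * (⟦ 5 ⟧ * L * N + ⟦ 2 ⟧) * b →
    σ ≡ L * L * r * r′ * b →
    ⟦ 2 ⟧ * S ≡ ⟦ 3 ⟧ + w + ⟦ 2 ⟧ * (N * N) * a - ⟦ 8 ⟧ * (N * N * N) * b * r →
    ⟦ 2 ⟧ * (S + σ) ≡ ⟦ 3 ⟧ + (w + (⟦ 3 ⟧ * N + 1ℚ) * b) + ⟦ 2 ⟧ * (L * L) * b - ⟦ 8 ⟧ * (L * L * L) * c * r′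
  algebra M r r′ a b c S w σ q₁ q₂ q₃ q₄ q₅ = combine
    (q₅ ⊞ ⟦ 2 ⟧ ⊡ q₄ ⊞ r′ ⊡ q₃ ⊞ (⟦ 2 ⟧ * b * (1ℚ - r′) - ⟦ 8 ⟧ * b * ((1ℚ + M) * (1ℚ + M) + (1ℚ + M) + 1ℚ)) ⊡ q₁
      ⊞ (b * (⟦ 10 ⟧ * (1ℚ + M) * (1ℚ + M) + ⟦ 15 ⟧ * (1ℚ + M) + ⟦ 9 ⟧) - ⟦ 2 ⟧ * (1ℚ + M) * (1ℚ + M) * a + ⟦ 2 ⟧ * b * (r * M + ⟦ 4 ⟧ * r)) ⊡ q₂)
    (solve (M ∷ r ∷ r′ ∷ a ∷ b ∷ c ∷ S ∷ w ∷ σ ∷ []) ℚ-ring)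

-- The partial fraction sum of (-1)ᵏ C(m,k) C(m+k,k)

v-num g-num : ℚ → ℕ → ℚ
v-num x k = - ((x - ⟦ k ⟧) * (x + ⟦ k ⟧ + 1ℚ))
g-num x k = - ((x - ⟦ k ⟧) * (x + ⟦ k ⟧))

sq : ℕ → ℕ
sq k = suc k ℕ.* suc k

-- v m k = (-1)ᵏ C(m,k) C(m+k,k)
v g : ℚ → ℕ → ℚ
v x = hyp (v-num x) sq
g x = hyp (g-num x) sq

hyp-sq-step : ∀ num k → hyp num sq (suc k) * (⟦ suc k ⟧ * ⟦ suc k ⟧) ≡ num k * hyp num sq k
hyp-sq-step num k = trans (cong (hyp num sq (suc k) *_) (sym (⟦⟧-homo-* (suc k) (suc k)))) (hyp-step num sq k)

v≡g₀ : ∀ x k → (1ℚ + x) * v x k ≡ (1ℚ + x - ⟦ k ⟧) * g (1ℚ + x) k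
v≡g₀ x = hyp-compare (v-num x) (g-num (1ℚ + x)) sq (λ _ → 1ℚ + x) (λ k → 1ℚ + x - ⟦ k ⟧) (v-num x)
  (base x) (λ k → *-comm _ (v-num x k)) (λ k → step x ⟦ k ⟧)
  where
  base : ∀ x → 1ℚ + x ≡ 1ℚ + x - 0ℚ
  base = solve-∀ ℚ-ring
  step : ∀ x k → (1ℚ + x - (1ℚ + k)) * - ((1ℚ + x - k) * (1ℚ + x + k)) ≡ - ((x - k) * (x + k + 1ℚ)) * (1ℚ + x - k)
  step = solve-∀ ℚ-ring

v≡g₁ : ∀ x k → (1ℚ + x) * v (1ℚ + x) k ≡ (1ℚ + x + ⟦ k ⟧) * g (1ℚ + x) k
v≡g₁ x = hyp-compare (v-num (1ℚ + x)) (g-num (1ℚ + x)) sq (λ _ → 1ℚ + x) (λ k → 1ℚ + x + ⟦ k ⟧) (v-num (1ℚ + x))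
  (base x) (λ k → *-comm _ (v-num (1ℚ + x) k)) (λ k → step x ⟦ k ⟧)
  where
  base : ∀ x → 1ℚ + x ≡ 1ℚ + x + 0ℚ
  base = solve-∀ ℚ-ring
  step : ∀ x k → (1ℚ + x + (1ℚ + k)) * - ((1ℚ + x - k) * (1ℚ + x + k)) ≡ - ((1ℚ + x - k) * (1ℚ + x + k + 1ℚ)) * (1ℚ + x + k)
  step = solve-∀ ℚ-ring

v-shift : ∀ x k → (1ℚ + x - ⟦ k ⟧) * v (1ℚ + x) k ≡ (1ℚ + x + ⟦ k ⟧) * v x k
v-shift x = hyp-compare (v-num (1ℚ + x)) (v-num x) sq (λ k → 1ℚ + x - ⟦ k ⟧) (λ k → 1ℚ + x + ⟦ k ⟧)
  (λ k → - ((x - ⟦ k ⟧) * (x + ⟦ k ⟧ + ⟦ 2 ⟧))) (base x) (λ k → step x ⟦ k ⟧) (λ k → step′ x ⟦ k ⟧)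
  where
  base : ∀ x → 1ℚ + x - 0ℚ ≡ 1ℚ + x + 0ℚ
  base = solve-∀ ℚ-ring
  step : ∀ x k → (1ℚ + x - (1ℚ + k)) * - ((1ℚ + x - k) * (1ℚ + x + k + 1ℚ)) ≡ - ((x - k) * (x + k + ⟦ 2 ⟧)) * (1ℚ + x - k)
  step = solve-∀ ℚ-ring
  step′ : ∀ x k → (1ℚ + x + (1ℚ + k)) * - ((x - k) * (x + k + 1ℚ)) ≡ - ((x - k) * (x + k + ⟦ 2 ⟧)) * (1ℚ + x + k)
  step′ = solve-∀ ℚ-ring

g-vanish : ∀ {n k} → n ℕ.< k → g ⟦ n ⟧ k ≡ 0ℚ
g-vanish {n} = hyp-vanish (g-num ⟦ n ⟧) sq (root ⟦ n ⟧)
  where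
  root : ∀ x → - ((x - x) * (x + x)) ≡ 0ℚ
  root = solve-∀ ℚ-ring

-- The sum of `v m k` over k is a shifted Legendre polynomial at an endpoint, hence (-1)ᵐ, and
-- consecutive values cancel. For y = m+1 the two terms add up to `2 * g y k`, and y² times this is
-- a difference of `-2k² g y k`.
∑v+v≡0 : ∀ K m → suc m ℕ.< K → ∑ K (λ k → v ⟦ m ⟧ k + v ⟦ suc m ⟧ k) ≡ 0ℚ
∑v+v≡0 K m sm<K = *⟦⟧-cancelʳ (suc m) (*⟦⟧-cancelʳ (suc m) (begin
  Σv * y * y                                        ≡⟨ swap Σv y ⟩
  y * y * Σv                                        ≡⟨ ∑-*ˡ K (y * y) (λ k → v ⟦ m ⟧ k + v y k) ⟨
  ∑ K (λ k → y * y * (v ⟦ m ⟧ k + v y k))           ≡⟨ ∑-telescope K G telescopes ⟩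
  G K - G 0                                         ≡⟨ cong (λ e → - (⟦ 2 ⟧ * (⟦ K ⟧ * ⟦ K ⟧) * e) - G 0) (g-vanish sm<K) ⟩
  - (⟦ 2 ⟧ * (⟦ K ⟧ * ⟦ K ⟧) * 0ℚ) - G 0            ≡⟨ zeros ⟦ K ⟧ y ⟩
  0ℚ * y * y                                        ∎))
  where
  y = ⟦ suc m ⟧
  Σv = ∑ K (λ k → v ⟦ m ⟧ k + v y k)
  G : ℕ → ℚ
  G k = - (⟦ 2 ⟧ * (⟦ k ⟧ * ⟦ k ⟧) * g y k)
  swap : ∀ s y → s * y * y ≡ y * y * s
  swap = solve-∀ ℚ-ring
  zeros : ∀ K y → - (⟦ 2 ⟧ * (K * K) * 0ℚ) - - (⟦ 2 ⟧ * (0ℚ * 0ℚ) * 1ℚ) ≡ 0ℚ * y * y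
  zeros = solve-∀ ℚ-ring
  algebra : ∀ y k a b e e′ → y * a ≡ (y - k) * e → y * b ≡ (y + k) * e →
    e′ * ((1ℚ + k) * (1ℚ + k)) ≡ - ((y - k) * (y + k)) * e →
    y * y * (a + b) ≡ - (⟦ 2 ⟧ * ((1ℚ + k) * (1ℚ + k)) * e′) - - (⟦ 2 ⟧ * (k * k) * e)
  algebra y k a b e e′ q₁ q₂ q₃ = combine (y ⊡ q₁ ⊞ y ⊡ q₂ ⊞ ⟦ 2 ⟧ ⊡ q₃) (solve (y ∷ k ∷ a ∷ b ∷ e ∷ e′ ∷ []) ℚ-ring)
  telescopes : ∀ k → y * y * (v ⟦ m ⟧ k + v y k) ≡ G (suc k) - G k
  telescopes k = algebra y ⟦ k ⟧ (v ⟦ m ⟧ k) (v y k) (g y k) (g y (suc k))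
    (v≡g₀ ⟦ m ⟧ k) (v≡g₁ ⟦ m ⟧ k) (hyp-sq-step (g-num y) k)

F : ℕ → ℕ → ℚ
F K m = ∑ K (λ k → v ⟦ m ⟧ k * recip (2 ℕ.+ 3 ℕ.* k))

⟦2+3k⟧ : ∀ k → ⟦ 2 ℕ.+ 3 ℕ.* k ⟧ ≡ ⟦ 2 ⟧ + ⟦ 3 ⟧ * ⟦ k ⟧
⟦2+3k⟧ k = trans (⟦⟧-homo-+ 2 (3 ℕ.* k)) (cong (⟦ 2 ⟧ +_) (⟦⟧-homo-* 3 k))

-- In `v-shift`, write 3(m+1-k) = (3m+5) - (3k+2) and 3(m+1+k) = (3m+1) + (3k+2), then divide by
-- 3k+2. The terms without denominator form the vanishing sum `∑v+v≡0`.
F-step : ∀ K m → suc m ℕ.< K → (⟦ 3 ⟧ * ⟦ m ⟧ + ⟦ 5 ⟧) * F K (suc m) ≡ (⟦ 3 ⟧ * ⟦ m ⟧ + 1ℚ) * F K m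
F-step K m sm<K = begin
  A * F K (suc m)                                     ≡⟨ ∑-*ˡ K A (λ k → v ⟦ suc m ⟧ k * r k) ⟨
  ∑ K (λ k → A * (v ⟦ suc m ⟧ k * r k))               ≡⟨ ∑-cong K (λ k → algebra ⟦ m ⟧ ⟦ k ⟧ (v ⟦ m ⟧ k) (v ⟦ suc m ⟧ k) (r k) (v-shift ⟦ m ⟧ k)
                                                           (trans (cong (r k *_) (sym (⟦2+3k⟧ k))) (recip-inverseˡ (2 ℕ.+ 3 ℕ.* k)))) ⟩
  ∑ K (λ k → B * (v ⟦ m ⟧ k * r k) + (v ⟦ m ⟧ k + v ⟦ suc m ⟧ k))
                                                      ≡⟨ ∑-+ K (λ k → B * (v ⟦ m ⟧ k * r k)) (λ k → v ⟦ m ⟧ k + v ⟦ suc m ⟧ k) ⟩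
  ∑ K (λ k → B * (v ⟦ m ⟧ k * r k)) + ∑ K (λ k → v ⟦ m ⟧ k + v ⟦ suc m ⟧ k)
                                                      ≡⟨ cong₂ _+_ (∑-*ˡ K B (λ k → v ⟦ m ⟧ k * r k)) (∑v+v≡0 K m sm<K) ⟩
  B * F K m + 0ℚ                                      ≡⟨ +-identityʳ _ ⟩
  B * F K m                                           ∎
  where
  A = ⟦ 3 ⟧ * ⟦ m ⟧ + ⟦ 5 ⟧
  B = ⟦ 3 ⟧ * ⟦ m ⟧ + 1ℚ
  r : ℕ → ℚ
  r k = recip (2 ℕ.+ 3 ℕ.* k)
  algebra : ∀ m k a b r → (1ℚ + m - k) * b ≡ (1ℚ + m + k) * a → r * (⟦ 2 ⟧ + ⟦ 3 ⟧ * k) ≡ 1ℚ →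
    (⟦ 3 ⟧ * m + ⟦ 5 ⟧) * (b * r) ≡ (⟦ 3 ⟧ * m + 1ℚ) * (a * r) + (a + b)
  algebra m k a b r q₁ q₂ = combine (⟦ 3 ⟧ * r ⊡ q₁ ⊞ (a + b) ⊡ q₂) (solve (m ∷ k ∷ a ∷ b ∷ r ∷ []) ℚ-ring)

-- Divisibility by powers of p in ℤ₍ₚ₎

module _ {p : ℕ} (pr : Prime p) where

  private instance
    p≢0 : ℕ.NonZero p
    p≢0 = prime⇒nonZero pr

  infix 4 _∣ₚ_
  -- x ∈ pʳ ℤ₍ₚ₎
  record _∣ₚ_ (r : ℕ) (x : ℚ) : Set where
    constructor fraction
    field
      denominator : ℕ
      numerator   : ℤ
      p∤den       : ¬ p ∣ denominator
      equation    : x * ⟦ denominator ⟧ ≡ numerator / 1 * ⟦ p ℕ.^ r ⟧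

  p∤1 : ¬ p ∣ 1
  p∤1 p∣1 = ¬prime[1] (subst Prime (∣1⇒≡1 p∣1) pr)

  p∤* : ∀ {a b} → ¬ p ∣ a → ¬ p ∣ b → ¬ p ∣ a ℕ.* b
  p∤* {a} {b} p∤a p∤b p∣ab = [ p∤a , p∤b ]′ (euclidsLemma a b pr p∣ab)

  p∤^ : ∀ {a} n → ¬ p ∣ a → ¬ p ∣ a ℕ.^ n
  p∤^ zero    p∤a = p∤1
  p∤^ (suc n) p∤a = p∤* p∤a (p∤^ n p∤a)

  ∣-+ : ∀ {r x y} → r ∣ₚ x → r ∣ₚ y → r ∣ₚ x + y
  ∣-+ {r} {x} {y} (fraction b a p∤b eq) (fraction b′ a′ p∤b′ eq′) =
    fraction (b ℕ.* b′) (a ℤ.* ℤ.+ b′ ℤ.+ a′ ℤ.* ℤ.+ b) (p∤* p∤b p∤b′) (begin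
    (x + y) * ⟦ b ℕ.* b′ ⟧                                    ≡⟨ cong ((x + y) *_) (⟦⟧-homo-* b b′) ⟩
    (x + y) * (⟦ b ⟧ * ⟦ b′ ⟧)                                ≡⟨ algebra x y ⟦ b ⟧ ⟦ b′ ⟧ (a / 1) (a′ / 1) ⟦ p ℕ.^ r ⟧ eq eq′ ⟩
    (a / 1 * ⟦ b′ ⟧ + a′ / 1 * ⟦ b ⟧) * ⟦ p ℕ.^ r ⟧           ≡⟨ cong (_* ⟦ p ℕ.^ r ⟧) (cong₂ _+_ (/1-*⟦⟧ a b′) (/1-*⟦⟧ a′ b)) ⟩
    ((a ℤ.* ℤ.+ b′) / 1 + (a′ ℤ.* ℤ.+ b) / 1) * ⟦ p ℕ.^ r ⟧   ≡⟨ cong (_* ⟦ p ℕ.^ r ⟧) (/1-homo-+ (a ℤ.* ℤ.+ b′) (a′ ℤ.* ℤ.+ b)) ⟨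
    (a ℤ.* ℤ.+ b′ ℤ.+ a′ ℤ.* ℤ.+ b) / 1 * ⟦ p ℕ.^ r ⟧         ∎)
    where
    /1-*⟦⟧ : ∀ i n → i / 1 * ⟦ n ⟧ ≡ (i ℤ.* ℤ.+ n) / 1
    /1-*⟦⟧ i n = trans (cong (i / 1 *_) (⟦⟧≡/1 n)) (sym (/1-homo-* i (ℤ.+ n)))
    algebra : ∀ x y b b′ a a′ q → x * b ≡ a * q → y * b′ ≡ a′ * q → (x + y) * (b * b′) ≡ (a * b′ + a′ * b) * q
    algebra x y b b′ a a′ q q₁ q₂ = combine (b′ ⊡ q₁ ⊞ b ⊡ q₂) (solve (x ∷ y ∷ b ∷ b′ ∷ a ∷ a′ ∷ q ∷ []) ℚ-ring)

  ∣-* : ∀ {r s x y} → r ∣ₚ x → s ∣ₚ y → r ℕ.+ s ∣ₚ x * y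
  ∣-* {r} {s} {x} {y} (fraction b a p∤b eq) (fraction b′ a′ p∤b′ eq′) =
    fraction (b ℕ.* b′) (a ℤ.* a′) (p∤* p∤b p∤b′) (begin
    x * y * ⟦ b ℕ.* b′ ⟧                              ≡⟨ cong (x * y *_) (⟦⟧-homo-* b b′) ⟩
    x * y * (⟦ b ⟧ * ⟦ b′ ⟧)                          ≡⟨ interchange x y ⟦ b ⟧ ⟦ b′ ⟧ ⟩
    x * ⟦ b ⟧ * (y * ⟦ b′ ⟧)                          ≡⟨ cong₂ _*_ eq eq′ ⟩
    a / 1 * ⟦ p ℕ.^ r ⟧ * (a′ / 1 * ⟦ p ℕ.^ s ⟧)      ≡⟨ interchange (a / 1) (a′ / 1) ⟦ p ℕ.^ r ⟧ ⟦ p ℕ.^ s ⟧ ⟨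
    a / 1 * (a′ / 1) * (⟦ p ℕ.^ r ⟧ * ⟦ p ℕ.^ s ⟧)    ≡⟨ cong₂ _*_ (/1-homo-* a a′) (trans (cong ⟦_⟧ (ℕ.^-distribˡ-+-* p r s)) (⟦⟧-homo-* (p ℕ.^ r) (p ℕ.^ s))) ⟨
    (a ℤ.* a′) / 1 * ⟦ p ℕ.^ (r ℕ.+ s) ⟧              ∎)
    where
    interchange : ∀ x y b b′ → x * y * (b * b′) ≡ x * b * (y * b′)
    interchange = solve-∀ ℚ-ring

  ∣-int : ∀ i → 0 ∣ₚ i / 1
  ∣-int i = fraction 1 i p∤1 refl

  ∣-nat : ∀ n → 0 ∣ₚ ⟦ n ⟧
  ∣-nat n = subst (0 ∣ₚ_) (sym (⟦⟧≡/1 n)) (∣-int (ℤ.+ n))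

  ∣-neg : ∀ {r x} → r ∣ₚ x → r ∣ₚ - x
  ∣-neg {r} {x} r∣x = subst (r ∣ₚ_) (minus x) (∣-* (∣-int (ℤ.- (ℤ.+ 1))) r∣x)
    where
    minus : ∀ x → - 1ℚ * x ≡ - x
    minus = solve-∀ ℚ-ring

  ∣-- : ∀ {r x y} → r ∣ₚ x → r ∣ₚ y → r ∣ₚ x - y
  ∣-- r∣x r∣y = ∣-+ r∣x (∣-neg r∣y)

  ∣-p : 1 ∣ₚ ⟦ p ⟧
  ∣-p = fraction 1 (ℤ.+ 1) p∤1 (trans (*-comm ⟦ p ⟧ 1ℚ) (cong (λ n → 1ℚ * ⟦ n ⟧) (sym (ℕ.*-identityʳ p))))

  ∣-cancel : ∀ {r x} c → ¬ p ∣ c → r ∣ₚ x * ⟦ c ⟧ → r ∣ₚ x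
  ∣-cancel {r} {x} c p∤c (fraction b a p∤b eq) = fraction (c ℕ.* b) a (p∤* p∤c p∤b)
    (trans (cong (x *_) (⟦⟧-homo-* c b)) (trans (sym (*-assoc x ⟦ c ⟧ ⟦ b ⟧)) eq))

  ∣-recip : ∀ c → ¬ p ∣ c → 0 ∣ₚ recip c
  ∣-recip zero      p∤0 = contradiction (divides 0 refl) p∤0
  ∣-recip c@(suc _) p∤c = ∣-cancel c p∤c (subst (0 ∣ₚ_) (sym (recip-inverseˡ c)) (∣-nat 1))

  ∣-cancel-p : ∀ {r x} → suc r ∣ₚ x * ⟦ p ⟧ → r ∣ₚ x
  ∣-cancel-p {r} {x} (fraction b a p∤b eq) = fraction b a p∤b (*⟦⟧-cancelʳ p (begin
    x * ⟦ b ⟧ * ⟦ p ⟧                      ≡⟨ swap x ⟦ b ⟧ ⟦ p ⟧ ⟩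
    x * ⟦ p ⟧ * ⟦ b ⟧                      ≡⟨ eq ⟩
    a / 1 * ⟦ p ℕ.* p ℕ.^ r ⟧              ≡⟨ cong (a / 1 *_) (⟦⟧-homo-* p (p ℕ.^ r)) ⟩
    a / 1 * (⟦ p ⟧ * ⟦ p ℕ.^ r ⟧)          ≡⟨ regroup (a / 1) ⟦ p ⟧ ⟦ p ℕ.^ r ⟧ ⟩
    a / 1 * ⟦ p ℕ.^ r ⟧ * ⟦ p ⟧            ∎))
    where
    swap : ∀ x b p → x * b * p ≡ x * p * b
    swap = solve-∀ ℚ-ring
    regroup : ∀ x b p → x * (b * p) ≡ x * p * b
    regroup = solve-∀ ℚ-ring

  ∣-weaken : ∀ {r x} → suc r ∣ₚ x → r ∣ₚ x
  ∣-weaken {r} {x} (fraction b a p∤b eq) = fraction b (a ℤ.* ℤ.+ p) p∤b (begin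
    x * ⟦ b ⟧                              ≡⟨ eq ⟩
    a / 1 * ⟦ p ℕ.* p ℕ.^ r ⟧              ≡⟨ cong (a / 1 *_) (⟦⟧-homo-* p (p ℕ.^ r)) ⟩
    a / 1 * (⟦ p ⟧ * ⟦ p ℕ.^ r ⟧)          ≡⟨ *-assoc (a / 1) ⟦ p ⟧ ⟦ p ℕ.^ r ⟧ ⟨
    a / 1 * ⟦ p ⟧ * ⟦ p ℕ.^ r ⟧            ≡⟨ cong (_* ⟦ p ℕ.^ r ⟧) (trans (cong (a / 1 *_) (⟦⟧≡/1 p)) (sym (/1-homo-* a (ℤ.+ p)))) ⟩
    (a ℤ.* ℤ.+ p) / 1 * ⟦ p ℕ.^ r ⟧        ∎)

  ∣-zero : ∀ r → r ∣ₚ 0ℚ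
  ∣-zero r = fraction 1 (ℤ.+ 0) p∤1 (sym (*-zeroˡ ⟦ p ℕ.^ r ⟧))

  ∣-∑ : ∀ {r} n {f : ℕ → ℚ} → (∀ k → k ℕ.< n → r ∣ₚ f k) → r ∣ₚ ∑ n f
  ∣-∑ {r} zero    r∣f = ∣-zero r
  ∣-∑ (suc n) r∣f = ∣-+ (r∣f 0 z<s) (∣-∑ n (λ k k<n → r∣f (suc k) (s<s k<n)))

  -- For y = n/d in lowest terms, n b = a d forces d to divide b, so a factor p of the reduced
  -- denominator would divide b.
  coprime-↧ : ∀ y b a → ¬ p ∣ b → y * ⟦ b ⟧ ≡ a / 1 → Coprime (↧ₙ y) p
  coprime-↧ y@(mkℚ n d-1 c) b a p∤b eq {e} (e∣d , e∣p) with prime⇒irreducible pr e∣p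
  ... | inj₁ e≡1 = e≡1
  ... | inj₂ refl = contradiction (∣-trans e∣d (coprime-divisor (Coprimality.sym (Coprimality.recompute c)) (divides ℤ.∣ a ∣ numerators))) p∤b
    where
    unnormalised : mkℚᵘ n d-1 ℚᵘ.* mkℚᵘ (ℤ.+ b) 0 ℚᵘ.≃ mkℚᵘ a 0
    unnormalised = begin′
      mkℚᵘ n d-1 ℚᵘ.* mkℚᵘ (ℤ.+ b) 0       ≈⟨ ℚᵘ.*-congˡ {mkℚᵘ n d-1} (toℚᵘ-fromℚᵘ (mkℚᵘ (ℤ.+ b) 0)) ⟨
      toℚᵘ y ℚᵘ.* toℚᵘ (ℤ.+ b / 1)         ≈⟨ toℚᵘ-homo-* y (ℤ.+ b / 1) ⟨
      toℚᵘ (y * (ℤ.+ b / 1))               ≈⟨ toℚᵘ-cong (trans (cong (y *_) (sym (⟦⟧≡/1 b))) eq) ⟩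
      toℚᵘ (a / 1)                         ≈⟨ toℚᵘ-fromℚᵘ (mkℚᵘ a 0) ⟩
      mkℚᵘ a 0                             ∎′
      where open ℚᵘ.≃-Reasoning renaming (begin_ to begin′_; _∎ to _∎′)
    numerators : ℤ.∣ n ∣ ℕ.* b ≡ ℤ.∣ a ∣ ℕ.* suc d-1
    numerators with unnormalised
    ... | *≡* eq′ = begin
      ℤ.∣ n ∣ ℕ.* b                        ≡⟨ ℤ.abs-* n (ℤ.+ b) ⟨
      ℤ.∣ n ℤ.* ℤ.+ b ∣                    ≡⟨ cong ℤ.∣_∣ (trans (sym (ℤ.*-identityʳ (n ℤ.* ℤ.+ b))) eq′) ⟩
      ℤ.∣ a ℤ.* ℤ.+ (suc d-1 ℕ.* 1) ∣      ≡⟨ ℤ.abs-* a (ℤ.+ (suc d-1 ℕ.* 1)) ⟩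
      ℤ.∣ a ∣ ℕ.* (suc d-1 ℕ.* 1)          ≡⟨ cong (ℤ.∣ a ∣ ℕ.*_) (ℕ.*-identityʳ (suc d-1)) ⟩
      ℤ.∣ a ∣ ℕ.* suc d-1                  ∎

  ∣⇒≡mod : ∀ r x y → r ∣ₚ x - y → x ≡ y [mod p ^ r ]
  ∣⇒≡mod r x y (fraction b a p∤b eq) = coprime-↧ ((x - y) * q) b a p∤b (begin
    (x - y) * q * ⟦ b ⟧              ≡⟨ swap (x - y) q ⟦ b ⟧ ⟩
    (x - y) * ⟦ b ⟧ * q              ≡⟨ cong (_* q) eq ⟩
    a / 1 * ⟦ p ℕ.^ r ⟧ * q          ≡⟨ regroup (a / 1) ⟦ p ℕ.^ r ⟧ q ⟩
    a / 1 * (q * ⟦ p ℕ.^ r ⟧)        ≡⟨ cong (a / 1 *_) (/-*-cancel (ℤ.+ 1) (p ℕ.^ r) {{ℕ.m^n≢0 p r}}) ⟩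
    a / 1 * 1ℚ                       ≡⟨ *-identityʳ (a / 1) ⟩
    a / 1                            ∎)
    where
    q = (ℤ.+ 1 / p ℕ.^ r) {{ℕ.m^n≢0 p r}}
    swap : ∀ x b p → x * b * p ≡ x * p * b
    swap = solve-∀ ℚ-ring
    regroup : ∀ x b p → x * b * p ≡ x * (p * b)
    regroup = solve-∀ ℚ-ring

≤-induction : ∀ (Q : ℕ → Set) {a} → Q a → (∀ n → a ℕ.≤ n → Q n → Q (suc n)) → ∀ n → a ℕ.≤ n → Q n
≤-induction Q base step n a≤n with ℕ.m≤n⇒m<n∨m≡n a≤n
... | inj₂ refl = base
≤-induction Q base step (suc n) a≤n | inj₁ (s≤s a≤n′) = step n a≤n′ (≤-induction Q base step n a≤n′)

-- Evaluation modulo p²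

module _ (i : ℕ) (0<i : 0 ℕ.< i) (pr : Prime (suc (6 ℕ.* i))) where

  private
    -- In terms of i, the numbers (p-1)/3 = 2i, (p-1)/2 = 3i and 2(p-1)/3 = 4i need no division.
    p m : ℕ
    p = suc (6 ℕ.* i)
    m = 3 ℕ.* i

    P M : ℚ
    P = ⟦ p ⟧
    M = ⟦ m ⟧

    infix 4 _∥_
    _∥_ : ℕ → ℚ → Set
    _∥_ = _∣ₚ_ pr

    p≡1+m+m : p ≡ suc m ℕ.+ m
    p≡1+m+m = identity i
      where
      identity : ∀ i → suc (6 ℕ.* i) ≡ suc (3 ℕ.* i) ℕ.+ 3 ℕ.* i
      identity = ℕ-solver.solve-∀

    P≡1+2M : P ≡ 1ℚ + ⟦ 2 ⟧ * M
    P≡1+2M = begin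
      ⟦ p ⟧                  ≡⟨ cong ⟦_⟧ p≡1+m+m ⟩
      1ℚ + ⟦ m ℕ.+ m ⟧       ≡⟨ cong (1ℚ +_) (⟦⟧-homo-+ m m) ⟩
      1ℚ + (M + M)           ≡⟨ double M ⟩
      1ℚ + ⟦ 2 ⟧ * M         ∎
      where
      double : ∀ x → 1ℚ + (x + x) ≡ 1ℚ + ⟦ 2 ⟧ * x
      double = solve-∀ ℚ-ring

    m<p : m ℕ.< p
    m<p = subst (m ℕ.<_) (sym p≡1+m+m) (ℕ.m≤m+n (suc m) m)

    p∤small : ∀ {k} → suc k ℕ.< p → ¬ p ∣ suc k
    p∤small = >⇒∤

    p∤2 : ¬ p ∣ 2
    p∤2 = p∤small (ℕ.≤-trans (s≤s (s≤s (s≤s z≤n))) (s≤s (ℕ.*-monoʳ-≤ 6 0<i)))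

    p∤den : ∀ {k} → suc k ℕ.< p → ¬ p ∣ den k
    p∤den {k} k<p = p∤* pr {8} {s ℕ.* s ℕ.* s ℕ.* s} (p∤^ pr {2} 3 p∤2)
      (p∤* pr {s ℕ.* s ℕ.* s} {s} (p∤* pr {s ℕ.* s} {s} (p∤* pr {s} {s} p∤s p∤s) p∤s) p∤s)
      where
      s = suc k
      p∤s = p∤small k<p

    -- The quotient is below 3 because 2+3k < 3p, and it is not 1 because p is 1 modulo 3 while 2+3k
    -- is 2.
    p∣2+3k⇒≡2p : ∀ {k} → k ℕ.< p → p ∣ 2 ℕ.+ 3 ℕ.* k → 2 ℕ.+ 3 ℕ.* k ≡ 2 ℕ.* p
    p∣2+3k⇒≡2p {k} k<p (divides (suc zero) eq) = contradiction (∣1⇒≡1 3∣1) λ ()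
      where
      reorder : ∀ i → 6 ℕ.* i ≡ 3 ℕ.* (2 ℕ.* i)
      reorder = ℕ-solver.solve-∀
      3∣1 : 3 ∣ 1
      3∣1 = ∣m+n∣m⇒∣n {3} {3 ℕ.* k} {1}
        (subst (3 ∣_) (trans (sym (reorder i)) (trans (sym (ℕ.+-identityʳ _)) (trans (sym (ℕ.suc-injective eq)) (ℕ.+-comm 1 (3 ℕ.* k))))) (m∣m*n (2 ℕ.* i)))
        (m∣m*n k)
    p∣2+3k⇒≡2p k<p (divides (suc (suc zero)) eq) = eq
    p∣2+3k⇒≡2p {k} (s≤s k≤6i) (divides (suc (suc (suc q))) eq) = contradiction too-big (ℕ.<⇒≱ small)
      where
      too-big : 3 ℕ.* p ℕ.≤ 2 ℕ.+ 3 ℕ.* k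
      too-big = subst (3 ℕ.* p ℕ.≤_) (sym eq) (ℕ.*-monoˡ-≤ p (s≤s (s≤s (s≤s (z≤n {q})))))
      expand : ∀ i → 3 ℕ.+ 3 ℕ.* (6 ℕ.* i) ≡ 3 ℕ.* suc (6 ℕ.* i)
      expand = ℕ-solver.solve-∀
      small : 2 ℕ.+ 3 ℕ.* k ℕ.< 3 ℕ.* p
      small = subst (2 ℕ.+ 3 ℕ.* k ℕ.<_) (expand i) (ℕ.+-monoʳ-≤ 3 (ℕ.*-monoʳ-≤ 3 k≤6i))

    -- Here 2+3k is at most 2+9i, below the only candidate 2p = 2+12i.
    p∤2+3k : ∀ {k} → k ℕ.≤ m → ¬ p ∣ 2 ℕ.+ 3 ℕ.* k
    p∤2+3k {k} k≤m p∣ = ℕ.<⇒≢ 2+3k<2p (p∣2+3k⇒≡2p (ℕ.≤-<-trans k≤m m<p) p∣)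
      where
      expand : ∀ i → 2 ℕ.+ 9 ℕ.* i ℕ.+ 1 ≡ 3 ℕ.+ 3 ℕ.* (3 ℕ.* i)
      expand = ℕ-solver.solve-∀
      expand′ : ∀ i → 2 ℕ.+ 9 ℕ.* i ℕ.+ 3 ℕ.* i ≡ 2 ℕ.* suc (6 ℕ.* i)
      expand′ = ℕ-solver.solve-∀
      2+3k<2p : 2 ℕ.+ 3 ℕ.* k ℕ.< 2 ℕ.* p
      2+3k<2p = ℕ.≤-trans (ℕ.+-monoʳ-≤ 3 (ℕ.*-monoʳ-≤ 3 k≤m)) (subst₂ ℕ._≤_ (expand i) (expand′ i)
        (ℕ.+-monoʳ-≤ (2 ℕ.+ 9 ℕ.* i) (ℕ.≤-trans 0<i (ℕ.m≤m+n i (2 ℕ.* i)))))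

    infixl 6 _⊕_ _⊖_
    infixl 7 _⊗_
    _⊕_ : ∀ {r x y} → r ∥ x → r ∥ y → r ∥ x + y
    _⊕_ = ∣-+ pr
    _⊖_ : ∀ {r x y} → r ∥ x → r ∥ y → r ∥ x - y
    _⊖_ = ∣-- pr
    _⊗_ : ∀ {r s x y} → r ∥ x → s ∥ y → r ℕ.+ s ∥ x * y
    _⊗_ = ∣-* pr

    nat : ∀ n → 0 ∥ ⟦ n ⟧
    nat = ∣-nat pr

    z-num-int : ∀ k → 0 ∥ z-num P k
    z-num-int k = ∣-neg pr ((nat p ⊕ nat 2 ⊗ nat k ⊕ nat 1) ⊗ (nat p ⊕ nat 2 ⊗ nat k ⊕ nat 2)
      ⊗ (nat p ⊖ nat k ⊖ nat 1) ⊗ (nat 2 ⊗ nat k ⊕ nat 1))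

    z-int : ∀ k → k ℕ.< p → 0 ∥ z P k
    z-int zero    _   = nat 1
    z-int (suc k) k<p = ∣-cancel pr (den k) (p∤den k<p)
      (subst (0 ∥_) (sym (hyp-step (z-num P) den k)) (z-num-int k ⊗ z-int k (ℕ.<-trans (ℕ.n<1+n k) k<p)))

    v-int : ∀ n k → k ℕ.< p → 0 ∥ v ⟦ n ⟧ k
    v-int n zero    _   = nat 1
    v-int n (suc k) k<p = ∣-cancel pr (sq k) (p∤* pr {suc k} {suc k} (p∤small k<p) (p∤small k<p))
      (subst (0 ∥_) (sym (hyp-step (v-num ⟦ n ⟧) sq k))
        (∣-neg pr ((nat n ⊖ nat k) ⊗ (nat n ⊕ nat k ⊕ nat 1)) ⊗ v-int n k (ℕ.<-trans (ℕ.n<1+n k) k<p)))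

    z≡v : ∀ k → k ℕ.< p → 1 ∥ z P k - v M k
    z≡v zero    _   = ∣-zero pr 1
    z≡v (suc k) k<p = ∣-cancel pr (den k) (p∤den k<p) (subst (1 ∥_) (sym step)
      (z-num-int k ⊗ z≡v k k<p′ ⊕ ∣-p pr ⊗ (c-int ⊗ v-int m k k<p′)))
      where
      k<p′ = ℕ.<-trans (ℕ.n<1+n k) k<p
      -- With e = k+1 and p = 1+2m, `p * c` is the difference between `z-num P k` and 8e² times
      -- `v-num M k`: the two term ratios, over the common denominator 8e⁴, agree modulo p.
      c : ℚ → ℚ → ℚ
      c k x = let e = 1ℚ + k; s = ⟦ 2 ⟧ * k + 1ℚ in
        ⟦ 2 ⟧ * e * e * (s + x) - s * (s * e + (e + s) * x + x * x)
      c-int : 0 ∥ c ⟦ k ⟧ P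
      c-int = nat 2 ⊗ e ⊗ e ⊗ (s ⊕ nat p) ⊖ s ⊗ (s ⊗ e ⊕ (e ⊕ s) ⊗ nat p ⊕ nat p ⊗ nat p)
        where
        e = nat (suc k)
        s = nat 2 ⊗ nat k ⊕ nat 1
      algebra : ∀ m k z z′ v v′ x → x ≡ 1ℚ + ⟦ 2 ⟧ * m → let e = 1ℚ + k; s = ⟦ 2 ⟧ * k + 1ℚ in
        z′ * (⟦ 8 ⟧ * (e * e * e * e)) ≡ - ((x + ⟦ 2 ⟧ * k + 1ℚ) * (x + ⟦ 2 ⟧ * k + ⟦ 2 ⟧) * (x - k - 1ℚ) * s) * z →
        v′ * (e * e) ≡ - ((m - k) * (m + k + 1ℚ)) * v →
        (z′ - v′) * (⟦ 8 ⟧ * (e * e * e * e)) ≡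
        - ((x + ⟦ 2 ⟧ * k + 1ℚ) * (x + ⟦ 2 ⟧ * k + ⟦ 2 ⟧) * (x - k - 1ℚ) * s) * (z - v)
        + x * ((⟦ 2 ⟧ * e * e * (s + x) - s * (s * e + (e + s) * x + x * x)) * v)
      algebra m k z z′ v v′ _ refl q₁ q₂ = combine (q₁ ⊞ (- (⟦ 8 ⟧ * ((1ℚ + k) * (1ℚ + k)))) ⊡ q₂)
        (solve (m ∷ k ∷ z ∷ z′ ∷ v ∷ v′ ∷ []) ℚ-ring)
      step : (z P (suc k) - v M (suc k)) * ⟦ den k ⟧ ≡ z-num P k * (z P k - v M k) + P * (c ⟦ k ⟧ P * v M k)
      step = trans (cong ((z P (suc k) - v M (suc k)) *_) (⟦den⟧ k))
        (algebra M ⟦ k ⟧ (z P k) (z P (suc k)) (v M k) (v M (suc k)) P P≡1+2M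
          (hyp-den-step (z-num P) k) (hyp-sq-step (v-num M) k))

    -- For k = m the factors p+2k+1 = 2p and 2k+1 = p of z-num both contain p.
    z-high : ∀ k → m ℕ.< k → k ℕ.< p → 2 ∥ z P k
    z-high = ≤-induction (λ k → k ℕ.< p → 2 ∥ z P k)
      (λ sm<p → ∣-cancel pr (den m) (p∤den sm<p) (subst (2 ∥_) (sym (trans (hyp-step (z-num P) den m) (cong (_* z P m) factor)))
        ((∣-p pr ⊗ ∣-p pr) ⊗ (∣-neg pr (nat 2 ⊗ (nat p ⊕ nat 2 ⊗ nat m ⊕ nat 2) ⊗ (nat p ⊖ nat m ⊖ nat 1))) ⊗ z-int m m<p)))
      (λ k _ 2∣z sk<p → ∣-cancel pr (den k) (p∤den sk<p) (subst (2 ∥_) (sym (hyp-step (z-num P) den k))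
        (z-num-int k ⊗ 2∣z (ℕ.<-trans (ℕ.n<1+n k) sk<p))))
      where
      algebra : ∀ m x → x ≡ 1ℚ + ⟦ 2 ⟧ * m →
        - ((x + ⟦ 2 ⟧ * m + 1ℚ) * (x + ⟦ 2 ⟧ * m + ⟦ 2 ⟧) * (x - m - 1ℚ) * (⟦ 2 ⟧ * m + 1ℚ)) ≡
        x * x * - (⟦ 2 ⟧ * (x + ⟦ 2 ⟧ * m + ⟦ 2 ⟧) * (x - m - 1ℚ))
      algebra m _ refl = solve (m ∷ []) ℚ-ring
      factor : z-num P m ≡ P * P * - (⟦ 2 ⟧ * (P + ⟦ 2 ⟧ * M + ⟦ 2 ⟧) * (P - M - 1ℚ))
      factor = algebra M P P≡1+2M

    -- The factor 3n+1 of the recursion equals p at n = 2i, between 0 and m = 3i.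
    F-divisible : 1 ∥ F (suc m) m
    F-divisible = ≤-induction (λ n → n ℕ.≤ m → 1 ∥ F (suc m) n) base step m 2i<m ℕ.≤-refl
      where
      2i<m : 2 ℕ.* i ℕ.< m
      2i<m = ℕ.+-monoˡ-≤ (2 ℕ.* i) 0<i
      ⟦5+3n⟧ : ∀ n → ⟦ 2 ℕ.+ 3 ℕ.* suc n ⟧ ≡ ⟦ 3 ⟧ * ⟦ n ⟧ + ⟦ 5 ⟧
      ⟦5+3n⟧ n = trans (⟦2+3k⟧ (suc n)) (identity ⟦ n ⟧)
        where
        identity : ∀ x → ⟦ 2 ⟧ + ⟦ 3 ⟧ * (1ℚ + x) ≡ ⟦ 3 ⟧ * x + ⟦ 5 ⟧
        identity = solve-∀ ℚ-ring
      -- The coefficient 3n+5 in `F-step` is 2+3(n+1), a unit as long as n+1 does not exceed m.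
      descend : ∀ n → suc n ℕ.≤ m → 1 ∥ (⟦ 3 ⟧ * ⟦ n ⟧ + 1ℚ) * F (suc m) n → 1 ∥ F (suc m) (suc n)
      descend n n<m 1∣ = ∣-cancel pr (2 ℕ.+ 3 ℕ.* suc n) (p∤2+3k n<m) (subst (1 ∥_) (sym (begin
        F (suc m) (suc n) * ⟦ 2 ℕ.+ 3 ℕ.* suc n ⟧        ≡⟨ *-comm _ ⟦ 2 ℕ.+ 3 ℕ.* suc n ⟧ ⟩
        ⟦ 2 ℕ.+ 3 ℕ.* suc n ⟧ * F (suc m) (suc n)        ≡⟨ cong (_* F (suc m) (suc n)) (⟦5+3n⟧ n) ⟩
        (⟦ 3 ⟧ * ⟦ n ⟧ + ⟦ 5 ⟧) * F (suc m) (suc n)      ≡⟨ F-step (suc m) n (s≤s n<m) ⟩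
        (⟦ 3 ⟧ * ⟦ n ⟧ + 1ℚ) * F (suc m) n               ∎)) 1∣)
      -- The cut-off `suc m` is long enough for `F-step` up to m and short enough to keep all
      -- denominators 2+3k prime to p.
      F-int : 0 ∥ F (suc m) (2 ℕ.* i)
      F-int = ∣-∑ pr (suc m) λ { k (s≤s k≤m) →
        v-int (2 ℕ.* i) k (ℕ.≤-<-trans k≤m m<p) ⊗ ∣-recip pr (2 ℕ.+ 3 ℕ.* k) (p∤2+3k k≤m) }
      3[2i]+1≡p : ⟦ 3 ⟧ * ⟦ 2 ℕ.* i ⟧ + 1ℚ ≡ P
      3[2i]+1≡p = trans (+-comm (⟦ 3 ⟧ * ⟦ 2 ℕ.* i ⟧) 1ℚ) (cong (1ℚ +_)
        (trans (sym (⟦⟧-homo-* 3 (2 ℕ.* i))) (cong ⟦_⟧ (sym (ℕ.*-assoc 3 2 i)))))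
      base : suc (2 ℕ.* i) ℕ.≤ m → 1 ∥ F (suc m) (suc (2 ℕ.* i))
      base 2i<m = descend (2 ℕ.* i) 2i<m (subst (λ x → 1 ∥ x * F (suc m) (2 ℕ.* i)) (sym 3[2i]+1≡p) (∣-p pr ⊗ F-int))
      step : ∀ n → suc (2 ℕ.* i) ℕ.≤ n → (n ℕ.≤ m → 1 ∥ F (suc m) n) → suc n ℕ.≤ m → 1 ∥ F (suc m) (suc n)
      step n _ 1∣F n<m = descend n n<m ((nat 3 ⊗ nat n ⊕ nat 1) ⊗ 1∣F (ℕ.<⇒≤ n<m))

    c : ℚ
    c = ⟦ 3 ⟧ * P - 1ℚ

    V-equation : ∀ k → V p k * ⟦ 2 ℕ.+ 3 ℕ.* k ⟧ ≡ c * (P * z P k)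
    V-equation k = begin
      V p k * ⟦ 2 ℕ.+ 3 ℕ.* k ⟧               ≡⟨ cong (V p k *_) (⟦2+3k⟧ k) ⟩
      V p k * (⟦ 2 ⟧ + ⟦ 3 ⟧ * ⟦ k ⟧)         ≡⟨ swap (V p k) ⟦ k ⟧ ⟩
      (⟦ 3 ⟧ * ⟦ k ⟧ + ⟦ 2 ⟧) * V p k         ≡⟨ V-closed p k ⟩
      c * ((P - ⟦ k ⟧) * t P k)               ≡⟨ cong (c *_) (t≡z P k) ⟩
      c * (P * z P k)                         ∎
      where
      swap : ∀ x k → x * (⟦ 2 ⟧ + ⟦ 3 ⟧ * k) ≡ (⟦ 3 ⟧ * k + ⟦ 2 ⟧) * x
      swap = solve-∀ ℚ-ring

    c-int : 0 ∥ c
    c-int = nat 3 ⊗ nat p ⊖ nat 1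

    -- The right side of `V-equation` is divisible by p³: one factor is explicit and two come from
    -- `z-high`. Only when 2+3k = 2p is one of them lost.
    V-high : ∀ k → m ℕ.< k → k ℕ.< p → 2 ∥ V p k
    V-high k m<k k<p with p ∣? (2 ℕ.+ 3 ℕ.* k)
    ... | no  p∤ = ∣-cancel pr (2 ℕ.+ 3 ℕ.* k) p∤ (subst (2 ∥_) (sym (V-equation k)) (∣-weaken pr (c-int ⊗ (∣-p pr ⊗ z-high k m<k k<p))))
    ... | yes p∣ = ∣-cancel pr 2 p∤2 (∣-cancel-p pr (subst (3 ∥_) (sym (begin
      V p k * ⟦ 2 ⟧ * P                       ≡⟨ *-assoc (V p k) ⟦ 2 ⟧ P ⟩
      V p k * (⟦ 2 ⟧ * P)                     ≡⟨ cong (V p k *_) (⟦⟧-homo-* 2 p) ⟨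
      V p k * ⟦ 2 ℕ.* p ⟧                     ≡⟨ cong (λ n → V p k * ⟦ n ⟧) (p∣2+3k⇒≡2p k<p p∣) ⟨
      V p k * ⟦ 2 ℕ.+ 3 ℕ.* k ⟧               ≡⟨ V-equation k ⟩
      c * (P * z P k)                         ∎)) (c-int ⊗ (∣-p pr ⊗ z-high k m<k k<p))))

    φ : ℕ → ℚ
    φ k = v M k * recip (2 ℕ.+ 3 ℕ.* k)

    -- After multiplication by the unit 2+3k the difference is `c * (P * (z P k - v M k))`, with one
    -- factor p explicit and one from `z≡v`.
    V-low : ∀ k → k ℕ.≤ m → 2 ∥ V p k - c * P * φ k
    V-low k k≤m = ∣-cancel pr (2 ℕ.+ 3 ℕ.* k) (p∤2+3k k≤m) (subst (2 ∥_)
      (sym (algebra (V p k) c P (z P k) (v M k) (recip (2 ℕ.+ 3 ℕ.* k)) ⟦ 2 ℕ.+ 3 ℕ.* k ⟧ (V-equation k) (recip-inverseˡ (2 ℕ.+ 3 ℕ.* k))))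
      (c-int ⊗ (∣-p pr ⊗ z≡v k (ℕ.≤-<-trans k≤m m<p))))
      where
      algebra : ∀ V c P z v r n → V * n ≡ c * (P * z) → r * n ≡ 1ℚ → (V - c * P * (v * r)) * n ≡ c * (P * (z - v))
      algebra V c P z v r n q₁ q₂ = combine (q₁ ⊞ (- (c * P * v)) ⊡ q₂) (solve (V ∷ c ∷ P ∷ z ∷ v ∷ r ∷ n ∷ []) ℚ-ring)

    W-divisible : 2 ∥ W p
    W-divisible = subst (2 ∥_) (sym split)
      (∣-∑ pr (suc m) (λ { k (s≤s k≤m) → V-low k k≤m }) ⊕ (c-int ⊗ ∣-p pr) ⊗ F-divisible
        ⊕ ∣-∑ pr m (λ k k<m → V-high (suc m ℕ.+ k) (s≤s (ℕ.m≤m+n m k)) (subst (suc m ℕ.+ k ℕ.<_) (sym p≡1+m+m) (ℕ.+-monoʳ-< (suc m) k<m))))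
      where
      1<p : 1 ℕ.< p
      1<p = s≤s (ℕ.≤-trans 0<i (ℕ.m≤m+n i _))
      V-split : ∀ a b → a ≡ a - b + b
      V-split = solve-∀ ℚ-ring
      split : W p ≡ ∑ (suc m) (λ k → V p k - c * P * φ k) + c * P * F (suc m) m + ∑ m (λ k → V p (suc m ℕ.+ k))
      split = begin
        W p
          ≡⟨ W≡∑V p 1<p ⟩
        ∑ p (V p)
          ≡⟨ cong (λ n → ∑ n (V p)) p≡1+m+m ⟩
        ∑ (suc m ℕ.+ m) (V p)
          ≡⟨ ∑-split (suc m) m (V p) ⟩
        ∑ (suc m) (V p) + ∑ m (λ k → V p (suc m ℕ.+ k))
          ≡⟨ cong (_+ ∑ m (λ k → V p (suc m ℕ.+ k))) (∑-cong (suc m) (λ k → V-split (V p k) (c * P * φ k))) ⟩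
        ∑ (suc m) (λ k → V p k - c * P * φ k + c * P * φ k) + ∑ m (λ k → V p (suc m ℕ.+ k))
          ≡⟨ cong (_+ ∑ m (λ k → V p (suc m ℕ.+ k))) (trans (∑-+ (suc m) (λ k → V p k - c * P * φ k) (λ k → c * P * φ k))
               (cong (∑ (suc m) (λ k → V p k - c * P * φ k) +_) (∑-*ˡ (suc m) (c * P) φ))) ⟩
        ∑ (suc m) (λ k → V p k - c * P * φ k) + c * P * F (suc m) m + ∑ m (λ k → V p (suc m ℕ.+ k)) ∎

    d-int : ∀ n → 0 ∥ d n
    d-int n = ∣-cancel pr (16 ℕ.^ n) (p∤^ pr n (p∤^ pr {2} 4 p∤2)) (subst (0 ∥_) (sym (d-* n)) (nat (Domb n)))

    -- At N = p the two boundary terms of `sum-telescoped` carry p² and p³, with p-integral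
    -- cofactors: powers of 16 and p-1 are units. The final 3/2 is half of the constant 3.
    boundary : ∀ n → 2 ℕ.+ n ≡ p → 2 ∥ ∑ n (λ l → summand (2 ℕ.+ l)) - ℤ.+ 3 / 2
    boundary n 2+n≡p = subst (2 ∥_) (sym (algebra S (W p) D D′ (recip (suc n)) P telescoped))
      (∣-recip pr 2 p∤2 ⊗ (W-divisible ⊕ nat 2 ⊗ (∣-p pr ⊗ ∣-p pr) ⊗ d-int (suc n)
        ⊖ ∣-weaken pr (nat 8 ⊗ (∣-p pr ⊗ ∣-p pr ⊗ ∣-p pr) ⊗ d-int p ⊗ ∣-recip pr (suc n) (p∤small (ℕ.≤-reflexive 2+n≡p)))))
      where
      S D D′ : ℚ
      S  = ∑ n (λ l → summand (2 ℕ.+ l))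
      D  = d (suc n)
      D′ = d p
      telescoped : ⟦ 2 ⟧ * S ≡ ⟦ 3 ⟧ + W p + ⟦ 2 ⟧ * (P * P) * D - ⟦ 8 ⟧ * (P * P * P) * D′ * recip (suc n)
      telescoped = subst (λ q → ⟦ 2 ⟧ * S ≡ ⟦ 3 ⟧ + W q + ⟦ 2 ⟧ * (⟦ q ⟧ * ⟦ q ⟧) * D - ⟦ 8 ⟧ * (⟦ q ⟧ * ⟦ q ⟧ * ⟦ q ⟧) * d q * recip (suc n))
        2+n≡p (sum-telescoped n)
      algebra : ∀ S w a b r x → ⟦ 2 ⟧ * S ≡ ⟦ 3 ⟧ + w + ⟦ 2 ⟧ * (x * x) * a - ⟦ 8 ⟧ * (x * x * x) * b * r →
        S - ℤ.+ 3 / 2 ≡ recip 2 * (w + ⟦ 2 ⟧ * (x * x) * a - ⟦ 8 ⟧ * (x * x * x) * b * r)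
      algebra S w a b r x q = combine (½ ⊡ q) (solve (S ∷ w ∷ a ∷ b ∷ r ∷ x ∷ []) ℚ-ring)

  sum-congruence : (sumFrom2Below (suc (6 ℕ.* i)) ≡ ℤ.+ 3 / 2 [mod suc (6 ℕ.* i) ^ 2 ])
  sum-congruence = ∣⇒≡mod pr 2 (sumFrom2Below p) (ℤ.+ 3 / 2) (subst (λ s → 2 ∥ s - ℤ.+ 3 / 2)
    (sym (foldr-+≡∑ (p ℕ.∸ 2) (λ l → summand (2 ℕ.+ l)) (λ k → k)))
    (boundary (p ℕ.∸ 2) (ℕ.m+[n∸m]≡n (s≤s (ℕ.≤-trans 0<i (ℕ.m≤m+n i (5 ℕ.* i)))))))

-- Reduction to primes of the form 6i+1

p≡1[mod6] : ∀ {p} → Prime p → p ℕ.% 3 ≡ 1 → ∃ λ i → 0 ℕ.< i × p ≡ suc (6 ℕ.* i)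
p≡1[mod6] {p} pr p%3≡1 = byParity (q ℕ.% 2) (m%n<n q 2) (m≡m%n+[m/n]*n q 2)
  where
  q = p ℕ./ 3
  p≡1+3q : p ≡ 1 ℕ.+ q ℕ.* 3
  p≡1+3q = trans (m≡m%n+[m/n]*n p 3) (cong (ℕ._+ q ℕ.* 3) p%3≡1)
  byParity : ∀ r → r ℕ.< 2 → q ≡ r ℕ.+ q ℕ./ 2 ℕ.* 2 → ∃ λ i → 0 ℕ.< i × p ≡ suc (6 ℕ.* i)
  byParity zero _ q≡2j = i , i-positive i p≡1+6i , p≡1+6i
    where
    i = q ℕ./ 2
    expand : ∀ j → 1 ℕ.+ j ℕ.* 2 ℕ.* 3 ≡ suc (6 ℕ.* j)
    expand = ℕ-solver.solve-∀
    p≡1+6i : p ≡ suc (6 ℕ.* i)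
    p≡1+6i = trans p≡1+3q (trans (cong (λ n → 1 ℕ.+ n ℕ.* 3) q≡2j) (expand i))
    i-positive : ∀ i → p ≡ suc (6 ℕ.* i) → 0 ℕ.< i
    i-positive zero    p≡1 = contradiction (subst Prime p≡1 pr) ¬prime[1]
    i-positive (suc _) _   = z<s
  -- An odd quotient would make p = 4+6j even, hence equal to 2, which is not 1 modulo 3.
  byParity (suc zero) _ q≡1+2j = [ (λ ()) , 2≢p ]′ (prime⇒irreducible pr 2∣p)
    where
    expand : ∀ j → 1 ℕ.+ (1 ℕ.+ j ℕ.* 2) ℕ.* 3 ≡ (2 ℕ.+ 3 ℕ.* j) ℕ.* 2
    expand = ℕ-solver.solve-∀
    2∣p : 2 ∣ p
    2∣p = divides (2 ℕ.+ 3 ℕ.* (q ℕ./ 2)) (trans p≡1+3q (trans (cong (λ n → 1 ℕ.+ n ℕ.* 3) q≡1+2j) (expand (q ℕ./ 2))))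
    2≢p : 2 ≡ p → ∃ λ i → 0 ℕ.< i × p ≡ suc (6 ℕ.* i)
    2≢p 2≡p = contradiction (trans (cong (ℕ._% 3) 2≡p) p%3≡1) λ ()
  byParity (suc (suc _)) (s≤s (s≤s ())) _

open import Data.Integer.Base using (+_)

theorem4p2 : (p : ℕ) (pr : Prime p) → p % 3 ≡ 1 →
    (sumFrom2Below p ≡ + 3 / 2 [mod p ^ 2 ]) {{prime⇒nonZero pr}}
theorem4p2 p pr p%3≡1 = fromForm pr (p≡1[mod6] pr p%3≡1)
  where
  -- Generalising over p allows matching on `refl`, which also rewrites the `NonZero` instance
  -- obtained from `pr`.
  fromForm : ∀ {p} (pr : Prime p) → (∃ λ i → 0 ℕ.< i × p ≡ suc (6 ℕ.* i)) →
    (sumFrom2Below p ≡ + 3 / 2 [mod p ^ 2 ]) {{prime⇒nonZero pr}}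
  fromForm pr (i , 0<i , refl) = sum-congruence i 0<i pr
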